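{- For every integer $k \geq 1$, $\mathrm{NTIME}(2^{kn}) \subseteq \textsc{Spec}_{2k+1}$.
   Context: For a positive integer $N$, $\mathsf{BINARY}(N)$ is its binary representation, and for $A\subseteq \mathbb{N}^+$, $\mathsf{BINARY}(A)$ is the set of binary representations of elements of $A$. $\mathrm{NTIME}(T(n))$ denotes the class of sets $A$ of positive integers such that $\mathsf{BINARY}(A)$ is accepted by a non-deterministic (possibly multi-tape) Turing machine in time $O(T(n))$, $n$ the input length. First-order sentences are over finite relational vocabularies, with equality. $\textsc{Spec}(\Phi)$ is the set of positive integers $n$ such that $\Phi$ has a model with universe of cardinality exactly $n$. $\textsc{Spec}_k$ is the class of all $\textsc{Spec}(\Phi)$ with $\Phi$ a first-order sentence using at most $k$ distinct variables (variables may be reused). -}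

module Defs where

open import Data.Nat using (ℕ; zero; suc; _+_; _*_; _≤_; _/_; _%_; _≡ᵇ_)
open import Data.Bool using (Bool; true; false; if_then_else_; _∧_; _∨_; not)
open import Data.Fin using (Fin; toℕ) renaming (zero to fz; suc to fs)
open import Data.Fin.Properties using () renaming (_≟_ to _≟F_)
open import Data.List using (List; []; _∷_; length; reverse; lookup)
open import Data.Vec using (Vec; tabulate)
open import Data.Product using (Σ; _×_; _,_)
open import Data.Sum using (_⊎_)
open import Relation.Binary.PropositionalEquality using (_≡_)
open import Relation.Nullary using (yes; no; isYes)
open import Function.Bundles using (_⇔_)

lsbDigits : ℕ → ℕ → List Bool
lsbDigits zero    _       = []
lsbDigits (suc f) zero    = []
lsbDigits (suc f) (suc m) = ((suc m % 2) ≡ᵇ 1) ∷ lsbDigits f (suc m / 2)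

-- BINARY(N) for N ≥ 1 (fuel N suffices)
binary : ℕ → List Bool
binary N = reverse (lsbDigits N N)

InBinary : (ℕ → Set) → List Bool → Set
InBinary A w = Σ ℕ λ N → (1 ≤ N) × A N × (binary N ≡ w)

data Move : Set where
  left stay right : Move

-- Tape alphabet Fin (3 + extra): fz = blank, 1 = symbol '0', 2 = symbol '1'.
-- There are (suc tapesM) ≥ 1 tapes; tape fz is the input tape.
-- Tapes are one-way infinite (cells ℕ); moving left at cell 0 stays at 0.
record NTM : Set where
  field
    tapesM  : ℕ
    statesM : ℕ
    extra   : ℕ
    start   : Fin statesM
    accept  : Fin statesM
    δ : Fin statesM → Vec (Fin (3 + extra)) (suc tapesM)
      → Fin statesM → Vec (Fin (3 + extra)) (suc tapesM) → Vec Move (suc tapesM)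
      → Bool

module _ (M : NTM) where
  open NTM M

  Γ : Set
  Γ = Fin (3 + extra)

  record Config : Set where
    constructor config
    field
      state : Fin statesM
      tape  : Fin (suc tapesM) → ℕ → Γ
      head  : Fin (suc tapesM) → ℕ

  open Config

  blank : Γ
  blank = fz

  bitSym : Bool → Γ
  bitSym false = fs fz
  bitSym true  = fs (fs fz)

  inputTape : List Bool → ℕ → Γ
  inputTape []      _       = blank
  inputTape (b ∷ w) zero    = bitSym b
  inputTape (b ∷ w) (suc i) = inputTape w i

  initConfig : List Bool → Config
  initConfig w = config start tp (λ _ → 0)
    where
    tp : Fin (suc tapesM) → ℕ → Γ
    tp fz     = inputTape w
    tp (fs _) = λ _ → blank

  moveHead : Move → ℕ → ℕ
  moveHead left  zero    = zero
  moveHead left  (suc h) = h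
  moveHead stay  h       = h
  moveHead right h       = suc h

  readSyms : Config → Vec Γ (suc tapesM)
  readSyms c = tabulate (λ i → tape c i (head c i))

  writeCell : (ℕ → Γ) → ℕ → Γ → ℕ → Γ
  writeCell t h s j with h Data.Nat.≟ j
  ... | yes _ = s
  ... | no  _ = t j

  next : Config → Fin statesM → Vec Γ (suc tapesM) → Vec Move (suc tapesM) → Config
  next c q' ws ms = config q'
    (λ i → writeCell (tape c i) (head c i) (Data.Vec.lookup ws i))
    (λ i → moveHead (Data.Vec.lookup ms i) (head c i))

  AccWithin : ℕ → Config → Set
  AccWithin zero    c = state c ≡ accept
  AccWithin (suc s) c = (state c ≡ accept) ⊎
    (Σ (Fin statesM) λ q' → Σ (Vec Γ (suc tapesM)) λ ws → Σ (Vec Move (suc tapesM)) λ ms →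
       (δ (state c) (readSyms c) q' ws ms ≡ true) × AccWithin s (next c q' ws ms))

NTIME : (ℕ → ℕ) → (ℕ → Set) → Set
NTIME T A = Σ NTM λ M → Σ ℕ λ c →
  (w : List Bool) → InBinary A w ⇔ AccWithin M (c * T (length w)) (initConfig M w)

record Vocab : Set where
  field
    nrel  : ℕ
    arity : Fin nrel → ℕ

data Formula (V : Vocab) (k : ℕ) : Set where
  _≐_  : Fin k → Fin k → Formula V k
  rel  : (R : Fin (Vocab.nrel V)) → Vec (Fin k) (Vocab.arity V R) → Formula V k
  ¬'_  : Formula V k → Formula V k
  _∧'_ : Formula V k → Formula V k → Formula V k
  _∨'_ : Formula V k → Formula V k → Formula V k
  ∃'   : Fin k → Formula V k → Formula V k
  ∀'   : Fin k → Formula V k → Formula V k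

Structure : Vocab → ℕ → Set
Structure V n = (R : Fin (Vocab.nrel V)) → Vec (Fin n) (Vocab.arity V R) → Bool

anyFin : (n : ℕ) → (Fin n → Bool) → Bool
anyFin zero    f = false
anyFin (suc n) f = f fz ∨ anyFin n (λ i → f (fs i))

allFin : (n : ℕ) → (Fin n → Bool) → Bool
allFin zero    f = true
allFin (suc n) f = f fz ∧ allFin n (λ i → f (fs i))

_[_↦_] : {k n : ℕ} → (Fin k → Fin n) → Fin k → Fin n → Fin k → Fin n
(ρ [ x ↦ a ]) y with x ≟F y
... | yes _ = a
... | no  _ = ρ y

eval : {V : Vocab} {k n : ℕ} → Structure V n → (Fin k → Fin n) → Formula V k → Bool
eval 𝔐 ρ (x ≐ y) with ρ x ≟F ρ y
... | yes _ = true
... | no  _ = false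
eval 𝔐 ρ (rel R xs) = 𝔐 R (Data.Vec.map ρ xs)
eval 𝔐 ρ (¬' φ)     = not (eval 𝔐 ρ φ)
eval 𝔐 ρ (φ ∧' ψ)   = eval 𝔐 ρ φ ∧ eval 𝔐 ρ ψ
eval 𝔐 ρ (φ ∨' ψ)   = eval 𝔐 ρ φ ∨ eval 𝔐 ρ ψ
eval {n = n} 𝔐 ρ (∃' x φ) = anyFin n (λ a → eval 𝔐 (ρ [ x ↦ a ]) φ)
eval {n = n} 𝔐 ρ (∀' x φ) = allFin n (λ a → eval 𝔐 (ρ [ x ↦ a ]) φ)

noFree : {V : Vocab} {k : ℕ} → (Fin k → Bool) → Formula V k → Bool
noFree β (x ≐ y)    = β x ∧ β y
noFree β (rel R xs) = Data.Vec.foldr _ (λ x b → β x ∧ b) true xs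
noFree β (¬' φ)     = noFree β φ
noFree β (φ ∧' ψ)   = noFree β φ ∧ noFree β ψ
noFree β (φ ∨' ψ)   = noFree β φ ∧ noFree β ψ
noFree β (∃' x φ)   = noFree (λ y → if isYes (x ≟F y) then true else β y) φ
noFree β (∀' x φ)   = noFree (λ y → if isYes (x ≟F y) then true else β y) φ

Sentence : {V : Vocab} {k : ℕ} → Formula V k → Set
Sentence φ = noFree (λ _ → false) φ ≡ true

Spec : {V : Vocab} {k : ℕ} → Formula V k → ℕ → Set
Spec {V} {k} Φ n = (1 ≤ n) × Σ (Structure V n) λ 𝔐 → (ρ : Fin k → Fin n) → eval 𝔐 ρ Φ ≡ true

InSpec : ℕ → (ℕ → Set) → Set
InSpec k A = Σ Vocab λ V → Σ (Formula V k) λ Φ → Sentence Φ × ((n : ℕ) → A n ⇔ Spec Φ n)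

{-# OPTIONS --safe #-}
module Submission where

-- An accepting run is a tiling of a time-by-space grid: a tile carries the
-- row data (state, symbols read, action) and the local tape content, and
-- correctness of the run is a condition on adjacent tiles.  On the universe
-- {0, …, N−1} with N ∈ [h, 2h), h a power of two, the running time is exactly
-- C hᵏ for a constant C, so a time or a position is a k-tuple of base-h digits
-- together with one of finitely many blocks.  This uses 2k variables for a
-- cell.  One further variable is enough to speak about the next cell, since
-- the digits that overflow are reset to zero and need not be remembered.
-- Order, doubling and the binary digits of N are axiomatised on the universe
-- by recursive equivalences, which have a unique solution.
open import Defs
open import Data.Bool using (Bool; true; false; _∧_; _∨_; if_then_else_)
import Data.Bool.Properties as Boolₚ
open import Data.Empty using (⊥-elim)
open import Data.Fin using (Fin; toℕ; fromℕ<; punchOut; combine; remQuot; splitAt; _↑ˡ_; _↑ʳ_) renaming (zero to fz; suc to fs)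
open import Data.Fin.Properties using (toℕ-fromℕ<; toℕ-injective; toℕ<n; punchOut-injective; any?; all?; injective⇒≤; remQuot-combine; ↑ˡ-injective; ↑ʳ-injective; splitAt-↑ˡ; splitAt-↑ʳ; splitAt⁻¹-↑ˡ; splitAt⁻¹-↑ʳ) renaming (_≟_ to _≟F_; suc-injective to fs-injective)
open import Data.Fin.Subset using (Subset; ∣_∣) renaming (_∈_ to _∈S_)
open import Data.Fin.Subset.Properties using (p⊂q⇒∣p∣<∣q∣; ∣⊤∣≡n; ∈⊤)
open import Data.List as List using (List; []; _∷_; length; reverse; _∷ʳ_)
open import Data.List.Membership.Propositional using (_∈_; _∉_)
open import Data.List.Membership.Propositional.Properties using (∈-tabulate⁺; ∈-tabulate⁻; ∈-allFin)
import Data.List.Properties as Listₚ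
open import Data.List.Relation.Unary.All as All using (All; []; _∷_)
import Data.List.Relation.Unary.All.Properties as Allₚ
open import Data.List.Relation.Unary.AllPairs using ([]; _∷_)
open import Data.List.Relation.Unary.Any using (here; there)
open import Data.List.Relation.Unary.Unique.Propositional using (Unique)
import Data.List.Relation.Unary.Unique.Propositional.Properties as Uniqueₚ
open import Data.Maybe using (Maybe; just; nothing; maybe)
import Data.Maybe.Properties as Maybeₚ
open import Data.Nat
open import Data.Nat.Divisibility using (divides)
open import Data.Nat.DivMod using (m≡m%n+[m/n]*n; [m+kn]%n≡m%n; m<n⇒m%n≡m; m%n<n; m*n/n≡m; m/n<m; m/n*n≤m; +-distrib-/-∣ʳ)
open import Data.Nat.Properties
open import Data.Product as Product using (Σ; _×_; _,_; proj₁; proj₂; map₁)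
open import Data.Sum as Sum using (_⊎_; inj₁; inj₂; [_,_]′)
open import Data.Vec as Vec using (Vec; []; _∷_; tabulate; lookup)
import Data.Vec.Properties as Vecₚ
open import Function using (id; _∘_; _$_)
open import Function.Bundles using (_⇔_; mk⇔; Equivalence)
open import Function.Construct.Composition using (_⇔-∘_)
open import Function.Construct.Symmetry using (⇔-sym)
open import Relation.Binary using (DecidableEquality; tri<; tri≈; tri>)
open import Relation.Binary.PropositionalEquality
open import Relation.Nullary using (¬_; Dec; yes; no; does; isYes; map′; _×-dec_; _→-dec_; _because_; ofʸ; ofⁿ)
open import Relation.Nullary.Reflects using (Reflects; of; ¬-reflects; _×-reflects_; _⊎-reflects_)

open Equivalence using (to; from)

-- Semantics of formulas

-- The hypothesis ties membership to acceptance within exactly `c * T n` steps. With more time the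
-- machine may accept words outside the set, so the number of rows has to be hit exactly and not
-- merely bounded. This is why the digits have base `h` instead of the size `N` of the universe: a
-- word has length l + 1 where h = 2^l, hence c 2^(k(l+1)) = (c 2^k) h^k, and the last row is the
-- tuple of zero digits in block C = c 2^k.
--
-- Two things are deliberately not axiomatised. Digits of size at least `h` are not excluded: a
-- tuple containing them is one more name of some cell, consistent in the intended model because
-- colours depend on the value alone, and ignored when a tiling is read off from a model. Nor need a
-- cell carry a single tile: it suffices that some tile is present and that the constraints bind all
-- of them.
--
-- The case k = 1 leaves just three variables, so the axioms of arithmetic also have to be written
-- with three, by requantifying variables inside their own scope.

updated : ∀ {k n} (ρ : Fin k → Fin n) x a → (ρ [ x ↦ a ]) x ≡ a
updated ρ x a with x ≟F x
... | yes _ = refl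
... | no ¬p = ⊥-elim (¬p refl)

not-updated : ∀ {k n} (ρ : Fin k → Fin n) {x} a {y} → x ≢ y → (ρ [ x ↦ a ]) y ≡ ρ y
not-updated ρ {x} a {y} x≢y with x ≟F y
... | yes p = ⊥-elim (x≢y p)
... | no _  = refl

update-cong : ∀ {k n} {ρ ρ′ : Fin k → Fin n} x a → (∀ y → x ≢ y → ρ y ≡ ρ′ y) →
              ∀ y → (ρ [ x ↦ a ]) y ≡ (ρ′ [ x ↦ a ]) y
update-cong x a eq y with x ≟F y
... | yes _ = refl
... | no ¬p = eq y ¬p

module _ {V : Vocab} {k n : ℕ} (𝔐 : Structure V n) where

  -- A type-valued counterpart of `eval`, so that proofs can handle witnesses and functions
  -- directly. The two agree because the universe is finite; `eval` also supplies the decidability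
  -- that makes `⇒'` behave as implication.
  Sat : (Fin k → Fin n) → Formula V k → Set
  Sat ρ (x ≐ y)    = ρ x ≡ ρ y
  Sat ρ (rel R xs) = 𝔐 R (Vec.map ρ xs) ≡ true
  Sat ρ (¬' φ)     = ¬ Sat ρ φ
  Sat ρ (φ ∧' ψ)   = Sat ρ φ × Sat ρ ψ
  Sat ρ (φ ∨' ψ)   = Sat ρ φ ⊎ Sat ρ ψ
  Sat ρ (∃' x φ)   = Σ (Fin n) λ a → Sat (ρ [ x ↦ a ]) φ
  Sat ρ (∀' x φ)   = (a : Fin n) → Sat (ρ [ x ↦ a ]) φ

  Sat-cong : ∀ φ {ρ ρ′} → ρ ≗ ρ′ → Sat ρ φ → Sat ρ′ φ
  Sat-cong (x ≐ y) eq s = trans (sym (eq x)) (trans s (eq y))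
  Sat-cong (rel R xs) eq s = trans (cong (𝔐 R) (sym (Vecₚ.map-cong eq xs))) s
  Sat-cong (¬' φ) eq s = s ∘ Sat-cong φ (sym ∘ eq)
  Sat-cong (φ ∧' ψ) eq (s , t) = Sat-cong φ eq s , Sat-cong ψ eq t
  Sat-cong (φ ∨' ψ) eq (inj₁ s) = inj₁ (Sat-cong φ eq s)
  Sat-cong (φ ∨' ψ) eq (inj₂ t) = inj₂ (Sat-cong ψ eq t)
  Sat-cong (∃' x φ) eq (a , s) = a , Sat-cong φ (update-cong x a (λ y _ → eq y)) s
  Sat-cong (∀' x φ) eq s a = Sat-cong φ (update-cong x a (λ y _ → eq y)) (s a)

≡true-reflects : ∀ b → Reflects (b ≡ true) b
≡true-reflects true  = of refl
≡true-reflects false = of (λ ())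

Reflects-map : ∀ {A B : Set} {b} → (A → B) → (B → A) → Reflects A b → Reflects B b
Reflects-map f g (ofʸ a)  = of (f a)
Reflects-map f g (ofⁿ ¬a) = of (¬a ∘ g)

anyFin-reflects : ∀ n {f : Fin n → Bool} {P : Fin n → Set} →
                  (∀ i → Reflects (P i) (f i)) → Reflects (Σ (Fin n) P) (anyFin n f)
anyFin-reflects zero    r = of λ ()
anyFin-reflects (suc n) r = Reflects-map
  [ fz ,_ , (λ (i , p) → fs i , p) ]′ (λ { (fz , p) → inj₁ p ; (fs i , p) → inj₂ (i , p) })
  (r fz ⊎-reflects anyFin-reflects n (r ∘ fs))

allFin-reflects : ∀ n {f : Fin n → Bool} {P : Fin n → Set} →
                  (∀ i → Reflects (P i) (f i)) → Reflects (∀ i → P i) (allFin n f)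
allFin-reflects zero    r = of λ ()
allFin-reflects (suc n) r = Reflects-map
  (λ { (p , q) fz → p ; (p , q) (fs i) → q i }) (λ p → p fz , p ∘ fs)
  (r fz ×-reflects allFin-reflects n (r ∘ fs))

module _ {V : Vocab} {k n : ℕ} (𝔐 : Structure V n) where

  eval-reflects : ∀ (φ : Formula V k) ρ → Reflects (Sat 𝔐 ρ φ) (eval 𝔐 ρ φ)
  eval-reflects (x ≐ y) ρ with ρ x ≟F ρ y
  ... | yes p = of p
  ... | no ¬p = of ¬p
  eval-reflects (rel R xs) ρ = ≡true-reflects _
  eval-reflects (¬' φ) ρ = ¬-reflects (eval-reflects φ ρ)
  eval-reflects (φ ∧' ψ) ρ = eval-reflects φ ρ ×-reflects eval-reflects ψ ρ
  eval-reflects (φ ∨' ψ) ρ = eval-reflects φ ρ ⊎-reflects eval-reflects ψ ρ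
  eval-reflects (∃' x φ) ρ = anyFin-reflects n (λ a → eval-reflects φ (ρ [ x ↦ a ]))
  eval-reflects (∀' x φ) ρ = allFin-reflects n (λ a → eval-reflects φ (ρ [ x ↦ a ]))

  Sat? : ∀ ρ (φ : Formula V k) → Dec (Sat 𝔐 ρ φ)
  Sat? ρ φ = eval 𝔐 ρ φ because eval-reflects φ ρ

  eval⇔Sat : ∀ ρ (φ : Formula V k) → (eval 𝔐 ρ φ ≡ true) ⇔ Sat 𝔐 ρ φ
  eval⇔Sat ρ φ with eval 𝔐 ρ φ | eval-reflects φ ρ
  ... | true  | ofʸ s  = mk⇔ (λ _ → s) (λ _ → refl)
  ... | false | ofⁿ ¬s = mk⇔ (λ ()) (λ s → ⊥-elim (¬s s))

-- Defined connectives and universal closure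

module _ {V : Vocab} {k : ℕ} where

  infixr 4 _⇒'_
  infix 3 _⇔'_

  _⇒'_ _⇔'_ : Formula V k → Formula V k → Formula V k
  φ ⇒' ψ = (¬' φ) ∨' ψ
  φ ⇔' ψ = (φ ⇒' ψ) ∧' (ψ ⇒' φ)

  close : List (Fin k) → Formula V k → Formula V k
  close []       φ = φ
  close (x ∷ xs) φ = ∀' x (close xs φ)

  if-true : ∀ c {d} → d ≡ true → (if c then true else d) ≡ true
  if-true true  _ = refl
  if-true false e = e

  noFree-bound : ∀ (φ : Formula V k) {β} → (∀ x → β x ≡ true) → noFree β φ ≡ true
  noFree-bound (x ≐ y) b = cong₂ _∧_ (b x) (b y)
  noFree-bound (rel R xs) {β} b = all xs
    where
    all : ∀ {m} (xs : Vec (Fin k) m) → Vec.foldr _ (λ x c → β x ∧ c) true xs ≡ true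
    all []       = refl
    all (x ∷ xs) = cong₂ _∧_ (b x) (all xs)
  noFree-bound (¬' φ) b = noFree-bound φ b
  noFree-bound (φ ∧' ψ) b = cong₂ _∧_ (noFree-bound φ b) (noFree-bound ψ b)
  noFree-bound (φ ∨' ψ) b = cong₂ _∧_ (noFree-bound φ b) (noFree-bound ψ b)
  noFree-bound (∃' x φ) b = noFree-bound φ λ y → if-true (isYes (x ≟F y)) (b y)
  noFree-bound (∀' x φ) b = noFree-bound φ λ y → if-true (isYes (x ≟F y)) (b y)

  noFree-close : ∀ xs (φ : Formula V k) {β} → (∀ y → β y ≡ true ⊎ y ∈ xs) →
                 noFree β (close xs φ) ≡ true
  noFree-close [] φ b = noFree-bound φ λ y → [ id , (λ ()) ]′ (b y)
  noFree-close (x ∷ xs) φ {β} b = noFree-close xs φ bound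
    where
    bound : ∀ y → (if isYes (x ≟F y) then true else β y) ≡ true ⊎ y ∈ xs
    bound y with x ≟F y | b y
    ... | yes _ | _                = inj₁ refl
    ... | no _  | inj₁ p           = inj₁ p
    ... | no ¬p | inj₂ (here e)    = ⊥-elim (¬p (sym e))
    ... | no _  | inj₂ (there y∈) = inj₂ y∈

  module _ {n : ℕ} (𝔐 : Structure V n) where

    Sat-⇒ : ∀ ρ φ ψ → Sat 𝔐 ρ (φ ⇒' ψ) ⇔ (Sat 𝔐 ρ φ → Sat 𝔐 ρ ψ)
    Sat-⇒ ρ φ ψ = mk⇔ [ (λ ¬s s → ⊥-elim (¬s s)) , (λ s _ → s) ]′ λ f → help f (Sat? 𝔐 ρ φ)
      where
      help : (Sat 𝔐 ρ φ → Sat 𝔐 ρ ψ) → Dec (Sat 𝔐 ρ φ) → ¬ Sat 𝔐 ρ φ ⊎ Sat 𝔐 ρ ψ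
      help f (yes s) = inj₂ (f s)
      help f (no ¬s) = inj₁ ¬s

    Sat-⇔ : ∀ ρ φ ψ → Sat 𝔐 ρ (φ ⇔' ψ) ⇔ (Sat 𝔐 ρ φ ⇔ Sat 𝔐 ρ ψ)
    Sat-⇔ ρ φ ψ = mk⇔ (λ (f , g) → mk⇔ (to (Sat-⇒ ρ φ ψ) f) (to (Sat-⇒ ρ ψ φ) g))
                    (λ e → from (Sat-⇒ ρ φ ψ) (to e) , from (Sat-⇒ ρ ψ φ) (from e))

    Sat-close⁺ : ∀ xs φ → (∀ ρ → Sat 𝔐 ρ φ) → ∀ ρ → Sat 𝔐 ρ (close xs φ)
    Sat-close⁺ []       φ s ρ   = s ρ
    Sat-close⁺ (x ∷ xs) φ s ρ a = Sat-close⁺ xs φ s (ρ [ x ↦ a ])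

    -- Each quantifier is instantiated with the value that `ρ′` gives to its variable, so the
    -- starting assignment matters only outside the list.
    Sat-close⁻ : ∀ xs φ {ρ} → Sat 𝔐 ρ (close xs φ) →
                 ∀ ρ′ → (∀ y → ρ y ≡ ρ′ y ⊎ y ∈ xs) → Sat 𝔐 ρ′ φ
    Sat-close⁻ [] φ s ρ′ eq = Sat-cong 𝔐 φ (λ y → [ id , (λ ()) ]′ (eq y)) s
    Sat-close⁻ (x ∷ xs) φ {ρ} s ρ′ eq = Sat-close⁻ xs φ (s (ρ′ x)) ρ′ eq′
      where
      eq′ : ∀ y → (ρ [ x ↦ ρ′ x ]) y ≡ ρ′ y ⊎ y ∈ xs
      eq′ y with x ≟F y | eq y
      ... | yes refl | _               = inj₁ refl
      ... | no _     | inj₁ e          = inj₁ e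
      ... | no ¬p    | inj₂ (here e)   = ⊥-elim (¬p (sym e))
      ... | no _     | inj₂ (there y∈) = inj₂ y∈

module _ {V : Vocab} {k : ℕ} where

  ⊤' ⊥' : Formula V (suc k)
  ⊤' = fz ≐ fz
  ⊥' = ¬' ⊤'

  ⋀ ⋁ : ∀ m → (Fin m → Formula V (suc k)) → Formula V (suc k)
  ⋀ zero    φ = ⊤'
  ⋀ (suc m) φ = φ fz ∧' ⋀ m (φ ∘ fs)
  ⋁ zero    φ = ⊥'
  ⋁ (suc m) φ = φ fz ∨' ⋁ m (φ ∘ fs)

  -- Conditions on tiles are facts about the machine, not about the structure. They are decided
  -- while the sentence is built, which then just lists the forbidden patterns.
  forbidUnless : {Q : Set} → Dec Q → Formula V (suc k) → Formula V (suc k)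
  forbidUnless (yes _) φ = ⊤'
  forbidUnless (no _)  φ = ¬' φ

  module _ {n : ℕ} (𝔐 : Structure V n) {ρ : Fin (suc k) → Fin n} where

    Sat-⋀ : ∀ m φ → Sat 𝔐 ρ (⋀ m φ) ⇔ (∀ i → Sat 𝔐 ρ (φ i))
    Sat-⋀ zero    φ = mk⇔ (λ _ ()) (λ _ → refl)
    Sat-⋀ (suc m) φ = mk⇔ (λ { (s , t) fz → s ; (s , t) (fs i) → to (Sat-⋀ m (φ ∘ fs)) t i })
                        (λ s → s fz , from (Sat-⋀ m (φ ∘ fs)) (s ∘ fs))

    Sat-⋁ : ∀ m φ → Sat 𝔐 ρ (⋁ m φ) ⇔ Σ (Fin m) λ i → Sat 𝔐 ρ (φ i)
    Sat-⋁ zero    φ = mk⇔ (λ s → ⊥-elim (s refl)) (λ ())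
    Sat-⋁ (suc m) φ = mk⇔
      [ fz ,_ , (λ t → let (i , s) = to (Sat-⋁ m (φ ∘ fs)) t in fs i , s) ]′
      (λ { (fz , s) → inj₁ s ; (fs i , s) → inj₂ (from (Sat-⋁ m (φ ∘ fs)) (i , s)) })

    Sat-forbidUnless : ∀ {Q} (Q? : Dec Q) φ → Sat 𝔐 ρ (forbidUnless Q? φ) ⇔ (Sat 𝔐 ρ φ → Q)
    Sat-forbidUnless (yes q) φ = mk⇔ (λ _ _ → q) (λ _ → refl)
    Sat-forbidUnless (no ¬q) φ = mk⇔ (λ ¬s s → ⊥-elim (¬s s)) (λ f s → ¬q (f s))

-- Machines as tiling systems

record Finite (X : Set) : Set where
  field
    size    : ℕ
    enc     : X → Fin size
    dec     : Fin size → X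
    dec-enc : ∀ x → dec (enc x) ≡ x

  ≡-dec : DecidableEquality X
  ≡-dec x y = map′ (λ e → trans (sym (dec-enc x)) (trans (cong dec e) (dec-enc y))) (cong enc) (enc x ≟F enc y)

open Finite using (≡-dec)

finite-retract : ∀ {X Y : Set} (f : X → Y) (g : Y → X) → (∀ x → g (f x) ≡ x) → Finite Y → Finite X
finite-retract f g gf F = record
  { size = size ; enc = enc ∘ f ; dec = g ∘ dec ; dec-enc = λ x → trans (cong g (dec-enc (f x))) (gf x) }
  where open Finite F

finite-Fin : ∀ n → Finite (Fin n)
finite-Fin n = record { size = n ; enc = id ; dec = id ; dec-enc = λ _ → refl }

finite-× : ∀ {X Y : Set} → Finite X → Finite Y → Finite (X × Y)
finite-× F G = record
  { size    = F.size * G.size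
  ; enc     = λ (x , y) → combine (F.enc x) (G.enc y)
  ; dec     = λ i → Product.map F.dec G.dec (remQuot G.size i)
  ; dec-enc = λ (x , y) → trans (cong (Product.map F.dec G.dec) (remQuot-combine (F.enc x) (G.enc y)))
                                (cong₂ _,_ (F.dec-enc x) (G.dec-enc y)) }
  where module F = Finite F
        module G = Finite G

finite-Maybe : ∀ {X : Set} → Finite X → Finite (Maybe X)
finite-Maybe {X} F = record { size = suc size ; enc = maybe (fs ∘ enc) fz ; dec = dec′ ; dec-enc = dec-enc′ }
  where
  open Finite F
  dec′ : Fin (suc size) → Maybe X
  dec′ fz     = nothing
  dec′ (fs i) = just (dec i)
  dec-enc′ : ∀ x → dec′ (maybe (fs ∘ enc) fz x) ≡ x
  dec-enc′ nothing  = refl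
  dec-enc′ (just x) = cong just (dec-enc x)

finite-Vec : ∀ {X : Set} → Finite X → ∀ n → Finite (Vec X n)
finite-Vec F zero    = finite-retract (λ _ → fz {0}) (λ _ → []) (λ { [] → refl }) (finite-Fin 1)
finite-Vec F (suc n) = finite-retract (λ v → Vec.head v , Vec.tail v) (λ (x , v) → x ∷ v)
                                      (λ { (x ∷ v) → refl }) (finite-× F (finite-Vec F n))

finite-Bool : Finite Bool
finite-Bool = finite-retract (λ { true → fz ; false → fs fz }) (λ { fz → true ; (fs _) → false })
                             (λ { true → refl ; false → refl }) (finite-Fin 2)

finite-Move : Finite Move
finite-Move = finite-retract (λ { left → fz ; stay → fs fz ; right → fs (fs fz) })
                             (λ { fz → left ; (fs fz) → stay ; (fs (fs _)) → right })
                             (λ { left → refl ; stay → refl ; right → refl }) (finite-Fin 3)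

symbolAt : List Bool → ℕ → Maybe Bool
symbolAt []      _       = nothing
symbolAt (b ∷ w) zero    = just b
symbolAt (b ∷ w) (suc i) = symbolAt w i

record TileSystem : Set₁ where
  field
    Tile           : Set
    finite         : Finite Tile
    Local          : Tile → Set
    LeftEdge       : Tile → Set
    Final          : Tile → Set
    Initial        : Maybe Bool → Tile → Set
    Horizontal     : Tile → Tile → Set
    Vertical       : Tile → Tile → Set
    local?         : ∀ c → Dec (Local c)
    leftEdge?      : ∀ c → Dec (LeftEdge c)
    final?         : ∀ c → Dec (Final c)
    initial?       : ∀ u c → Dec (Initial u c)
    horizontal?    : ∀ c d → Dec (Horizontal c d)
    vertical?      : ∀ c d → Dec (Vertical c d)

-- P t p c says that tile c is placed in row t and column p.  Several tiles
-- may share a cell; the constraints then hold for all of them.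
record Tiling (S : TileSystem) (u : ℕ → Maybe Bool) (T : ℕ)
              (P : ℕ → ℕ → TileSystem.Tile S → Set) : Set where
  open TileSystem S
  field
    total      : ∀ t p → t ≤ T → p ≤ T + T → Σ Tile (P t p)
    local      : ∀ {t p c} → P t p c → Local c
    leftEdge   : ∀ {t c} → P t 0 c → LeftEdge c
    horizontal : ∀ {t p c d} → P t p c → P t (suc p) d → Horizontal c d
    vertical   : ∀ {t p c d} → P t p c → P (suc t) p d → Vertical c d
    initial    : ∀ {p c} → P 0 p c → Initial (u p) c
    final      : ∀ {c} → P T 0 c → Final c

≡ᵇ-true : ∀ {h p} → (h ≡ᵇ p) ≡ true → h ≡ p
≡ᵇ-true {h} {p} e = ≡ᵇ⇒≡ h p (Equivalence.from Boolₚ.T-≡ e)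

0≡ᵇ : ∀ p → (0 ≡ᵇ p) ≡ (p ≡ᵇ 0)
0≡ᵇ zero    = refl
0≡ᵇ (suc p) = refl

-- The tiling system of a Turing machine

module Machine (M : NTM) where
  open NTM M
  open Config

  m : ℕ
  m = suc tapesM

  Action : Set
  Action = Maybe (Fin statesM × Vec (Γ M) m × Vec Move m)

  -- A tile records the state, the symbols under the heads and the action of
  -- its row (nothing: the accepting machine idles) and, for every tape, the
  -- content of its cell and whether the head is there before and after the action.
  record MTile : Set where
    constructor mtile
    field
      state′ : Fin statesM
      reads  : Vec (Γ M) m
      action : Action
      cell   : Vec (Γ M) m
      headAt   : Vec Bool m
      headAt⁺  : Vec Bool m
      origin : Bool

  open MTile

  MTile-finite : Finite MTile
  MTile-finite = finite-retract
    (λ (mtile q r a c h h⁺ o) → q , r , a , c , h , h⁺ , o)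
    (λ (q , r , a , c , h , h⁺ , o) → mtile q r a c h h⁺ o) (λ _ → refl)
    (finite-× Q $ finite-× Γs $ finite-× finA $ finite-× Γs $ finite-× Bs $ finite-× Bs finite-Bool)
    where
    Q    = finite-Fin statesM
    Γs   = finite-Vec (finite-Fin (3 + extra)) m
    Bs   = finite-Vec finite-Bool m
    finA = finite-Maybe (finite-× Q (finite-× Γs (finite-Vec finite-Move m)))

  action-≡-dec : DecidableEquality Action
  action-≡-dec = ≡-dec (finite-Maybe (finite-× (finite-Fin statesM)
    (finite-× (finite-Vec (finite-Fin (3 + extra)) m) (finite-Vec finite-Move m))))

  _≟Γ_ : DecidableEquality (Vec (Γ M) m)
  _≟Γ_ = Vecₚ.≡-dec _≟F_

  _≟M_ : DecidableEquality Move
  _≟M_ = ≡-dec finite-Move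

  move : Action → Fin m → Move
  move nothing              i = stay
  move (just (_ , _ , ms)) i = lookup ms i

  written : Action → Vec (Γ M) m → Fin m → Γ M
  written nothing              r i = lookup r i
  written (just (_ , ws , _)) r i = lookup ws i

  target : Action → Fin statesM → Fin statesM
  target nothing              q = q
  target (just (q′ , _ , _)) q = q′

  Legal : Fin statesM → Vec (Γ M) m → Action → Set
  Legal q r nothing                 = q ≡ accept
  Legal q r (just (q′ , ws , ms)) = δ q r q′ ws ms ≡ true

  legal? : ∀ q r a → Dec (Legal q r a)
  legal? q r nothing                 = q ≟F accept
  legal? q r (just (q′ , ws , ms)) = δ q r q′ ws ms Boolₚ.≟ true

  inputSym : Maybe Bool → Fin m → Γ M
  inputSym u fz     = maybe (bitSym M) (blank M) u
  inputSym u (fs _) = blank M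

  -- The heads of the tapes stand in different columns, so no single tile sees all the symbols read.
  -- Every tile of a row therefore carries the same guess of state, symbols and action: `Horizontal`
  -- copies it along the row, and `Local` checks the symbol of a tape in the column where its head
  -- stands. Head movements become relations between `headAt` and `headAt⁺` of neighbours, and
  -- `Vertical` hands the result to the next row.
  tileSystem : TileSystem
  tileSystem = record
    { Tile       = MTile
    ; finite     = MTile-finite
    ; Local      = λ c → Legal (state′ c) (reads c) (action c)
        × (∀ i → lookup (headAt c) i ≡ true → lookup (cell c) i ≡ lookup (reads c) i)
        × (∀ i → move (action c) i ≡ stay → lookup (headAt⁺ c) i ≡ lookup (headAt c) i)
        -- No head enters column 0 from its left; at the other columns a move to the right is
        -- governed by `Horizontal`.
        × (origin c ≡ true → ∀ i → move (action c) i ≡ right → lookup (headAt⁺ c) i ≡ false)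
    ; LeftEdge   = λ c → origin c ≡ true
    ; Final      = λ c → state′ c ≡ accept
    ; Initial    = λ u c → state′ c ≡ start
        × (∀ i → lookup (cell c) i ≡ inputSym u i)
        × (∀ i → lookup (headAt c) i ≡ origin c)
    ; Horizontal = λ c d → state′ d ≡ state′ c × reads d ≡ reads c × action d ≡ action c × origin d ≡ false
        × (∀ i → move (action c) i ≡ right → lookup (headAt⁺ d) i ≡ lookup (headAt c) i)
        -- The second disjunct keeps a head at cell 0 that tries to move left.
        × (∀ i → move (action c) i ≡ left →
             lookup (headAt⁺ c) i ≡ lookup (headAt d) i ∨ (origin c ∧ lookup (headAt c) i))
    ; Vertical   = λ c d → state′ d ≡ target (action c) (state′ c)
        × (∀ i → lookup (cell d) i ≡
             (if lookup (headAt c) i then written (action c) (reads c) i else lookup (cell c) i))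
        × (∀ i → lookup (headAt d) i ≡ lookup (headAt⁺ c) i)
    ; local?     = λ c → legal? (state′ c) (reads c) (action c)
        ×-dec all? (λ i → (lookup (headAt c) i Boolₚ.≟ true) →-dec (lookup (cell c) i ≟F lookup (reads c) i))
        ×-dec all? (λ i → (move (action c) i ≟M stay) →-dec (lookup (headAt⁺ c) i Boolₚ.≟ lookup (headAt c) i))
        ×-dec ((origin c Boolₚ.≟ true) →-dec
               all? (λ i → (move (action c) i ≟M right) →-dec (lookup (headAt⁺ c) i Boolₚ.≟ false)))
    ; leftEdge?  = λ c → origin c Boolₚ.≟ true
    ; final?     = λ c → state′ c ≟F accept
    ; initial?   = λ u c → (state′ c ≟F start)
        ×-dec all? (λ i → lookup (cell c) i ≟F inputSym u i)
        ×-dec all? (λ i → lookup (headAt c) i Boolₚ.≟ origin c)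
    ; horizontal? = λ c d → (state′ d ≟F state′ c) ×-dec (reads d ≟Γ reads c)
        ×-dec action-≡-dec (action d) (action c) ×-dec (origin d Boolₚ.≟ false)
        ×-dec all? (λ i → (move (action c) i ≟M right) →-dec (lookup (headAt⁺ d) i Boolₚ.≟ lookup (headAt c) i))
        ×-dec all? (λ i → (move (action c) i ≟M left) →-dec
                (lookup (headAt⁺ c) i Boolₚ.≟ (lookup (headAt d) i ∨ (origin c ∧ lookup (headAt c) i))))
    ; vertical?  = λ c d → (state′ d ≟F target (action c) (state′ c))
        ×-dec all? (λ i → lookup (cell d) i ≟F
                (if lookup (headAt c) i then written (action c) (reads c) i else lookup (cell c) i))
        ×-dec all? (λ i → lookup (headAt d) i Boolₚ.≟ lookup (headAt⁺ c) i)
    }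

  inputTape-symbolAt : ∀ w p → inputTape M w p ≡ maybe (bitSym M) (blank M) (symbolAt w p)
  inputTape-symbolAt []      p       = refl
  inputTape-symbolAt (b ∷ w) zero    = refl
  inputTape-symbolAt (b ∷ w) (suc p) = inputTape-symbolAt w p

  initTape-symbolAt : ∀ w i p → tape (initConfig M w) i p ≡ inputSym (symbolAt w p) i
  initTape-symbolAt w fz     p = inputTape-symbolAt w p
  initTape-symbolAt w (fs _) p = refl

  writeCell-if : ∀ (f : ℕ → Γ M) h s p → writeCell M f h s p ≡ (if h ≡ᵇ p then s else f p)
  writeCell-if f h s p with h ≟ p
  ... | yes h≡p rewrite Equivalence.to Boolₚ.T-≡ (≡⇒≡ᵇ h p h≡p) = refl
  ... | no h≢p  rewrite Boolₚ.¬-not (h≢p ∘ ≡ᵇ-true {h} {p}) = refl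

  moveLeft≡ᵇ : ∀ h p → (moveHead M left h ≡ᵇ p) ≡ (h ≡ᵇ suc p) ∨ ((p ≡ᵇ 0) ∧ (h ≡ᵇ p))
  moveLeft≡ᵇ zero    zero    = refl
  moveLeft≡ᵇ zero    (suc p) = refl
  moveLeft≡ᵇ (suc h) zero    = sym (Boolₚ.∨-identityʳ _)
  moveLeft≡ᵇ (suc h) (suc p) = sym (Boolₚ.∨-identityʳ _)

  -- From accepting runs to tilings

  module FromRun where

    step : Config M → Action → Config M
    step c nothing                  = c
    step c (just (q′ , ws , ms)) = next M c q′ ws ms

    Snapshot : Set
    Snapshot = Config M × Action

    -- An early acceptance is prolonged by idle rows, so the run has a snapshot at every time and is
    -- still accepting at time `s`.
    run : ∀ s c → AccWithin M s c → ℕ → Snapshot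
    run zero    c acc                                t       = c , nothing
    run (suc s) c (inj₁ acc)                         t       = c , nothing
    run (suc s) c (inj₂ (q′ , ws , ms , _ , acc)) zero    = c , just (q′ , ws , ms)
    run (suc s) c (inj₂ (q′ , ws , ms , _ , acc)) (suc t) = run s (next M c q′ ws ms) acc t

    run-start : ∀ s c acc → proj₁ (run s c acc 0) ≡ c
    run-start zero    c acc      = refl
    run-start (suc s) c (inj₁ _) = refl
    run-start (suc s) c (inj₂ _) = refl

    run-step : ∀ s c acc t → proj₁ (run s c acc (suc t)) ≡ step (proj₁ (run s c acc t)) (proj₂ (run s c acc t))
    run-step zero    c acc      t       = refl
    run-step (suc s) c (inj₁ _) t       = refl
    run-step (suc s) c (inj₂ (q′ , ws , ms , _ , acc)) zero    = run-start s _ acc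
    run-step (suc s) c (inj₂ (q′ , ws , ms , _ , acc)) (suc t) = run-step s _ acc t

    LegalAt : Snapshot → Set
    LegalAt (c , a) = Legal (state c) (readSyms M c) a

    run-legal : ∀ s c acc t → LegalAt (run s c acc t)
    run-legal zero    c acc        t       = acc
    run-legal (suc s) c (inj₁ acc) t       = acc
    run-legal (suc s) c (inj₂ (q′ , ws , ms , ok , acc)) zero    = ok
    run-legal (suc s) c (inj₂ (q′ , ws , ms , ok , acc)) (suc t) = run-legal s _ acc t

    run-accepts : ∀ s c acc → state (proj₁ (run s c acc s)) ≡ accept
    run-accepts zero    c acc        = acc
    run-accepts (suc s) c (inj₁ acc) = acc
    run-accepts (suc s) c (inj₂ (q′ , ws , ms , _ , acc)) = run-accepts s _ acc

    tileOf : Snapshot → ℕ → MTile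
    tileOf (c , a) p = mtile (state c) (readSyms M c) a
      (tabulate λ i → tape c i p) (tabulate λ i → head c i ≡ᵇ p)
      (tabulate λ i → moveHead M (move a i) (head c i) ≡ᵇ p) (p ≡ᵇ 0)

    module _ (c : Config M) (a : Action) (p : ℕ) (i : Fin m) where

      reads-of : lookup (readSyms M c) i ≡ tape c i (head c i)
      reads-of = Vecₚ.lookup∘tabulate (λ j → tape c j (head c j)) i

      cell-of : lookup (cell (tileOf (c , a) p)) i ≡ tape c i p
      cell-of = Vecₚ.lookup∘tabulate (λ j → tape c j p) i

      headAt-of : lookup (headAt (tileOf (c , a) p)) i ≡ (head c i ≡ᵇ p)
      headAt-of = Vecₚ.lookup∘tabulate (λ j → head c j ≡ᵇ p) i

      headAt⁺-of : lookup (headAt⁺ (tileOf (c , a) p)) i ≡ (moveHead M (move a i) (head c i) ≡ᵇ p)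
      headAt⁺-of = Vecₚ.lookup∘tabulate (λ j → moveHead M (move a j) (head c j) ≡ᵇ p) i

      headAt⁺-of-move : ∀ {x} → move a i ≡ x →
                      lookup (headAt⁺ (tileOf (c , a) p)) i ≡ (moveHead M x (head c i) ≡ᵇ p)
      headAt⁺-of-move e = trans headAt⁺-of (cong (λ x → moveHead M x (head c i) ≡ᵇ p) e)

    step-tape : ∀ c a p i → tape (step c a) i p
              ≡ (if head c i ≡ᵇ p then written a (readSyms M c) i else tape c i p)
    step-tape c (just (q′ , ws , ms)) p i = writeCell-if (tape c i) (head c i) (lookup ws i) p
    -- An idle row writes back the very symbol that it reads.
    step-tape c nothing p i with head c i ≡ᵇ p in e
    ... | true  = sym (trans (reads-of c nothing p i) (cong (tape c i) (≡ᵇ-true {head c i} {p} e)))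
    ... | false = refl

    step-head : ∀ c a i → head (step c a) i ≡ moveHead M (move a i) (head c i)
    step-head c (just _) i = refl
    step-head c nothing  i = refl

    step-state : ∀ c a → state (step c a) ≡ target a (state c)
    step-state c nothing  = refl
    step-state c (just _) = refl

    open TileSystem tileSystem using (Local; Horizontal; Vertical; Initial)

    tileOf-local : ∀ s p → LegalAt s → Local (tileOf s p)
    tileOf-local (c , a) p legal = legal
      , (λ i e → trans (cell-of c a p i)
          (trans (cong (tape c i) (sym (≡ᵇ-true {head c i} {p} (trans (sym (headAt-of c a p i)) e))))
                 (sym (reads-of c a p i))))
      , (λ i e → trans (headAt⁺-of-move c a p i e) (sym (headAt-of c a p i)))
      , (λ o i e → trans (headAt⁺-of-move c a p i e) (cong (suc (head c i) ≡ᵇ_) (≡ᵇ-true {p} {0} o)))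

    tileOf-horizontal : ∀ s p → Horizontal (tileOf s p) (tileOf s (suc p))
    tileOf-horizontal (c , a) p = refl , refl , refl , refl
      , (λ i e → trans (headAt⁺-of-move c a (suc p) i e) (sym (headAt-of c a p i)))
      , λ i e → trans (headAt⁺-of-move c a p i e) (trans (moveLeft≡ᵇ (head c i) p)
          (sym (cong₂ (λ x y → x ∨ ((p ≡ᵇ 0) ∧ y)) (headAt-of c a (suc p) i) (headAt-of c a p i))))

    tileOf-vertical : ∀ c a b p → Vertical (tileOf (c , a) p) (tileOf (step c a , b) p)
    tileOf-vertical c a b p = step-state c a
      , (λ i → trans (cell-of (step c a) b p i) (trans (step-tape c a p i)
          (sym (cong₂ (λ x y → if x then written a (readSyms M c) i else y) (headAt-of c a p i) (cell-of c a p i)))))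
      , λ i → trans (headAt-of (step c a) b p i)
          (trans (cong (_≡ᵇ p) (step-head c a i)) (sym (headAt⁺-of c a p i)))

    tileOf-initial : ∀ w a p → Initial (symbolAt w p) (tileOf (initConfig M w , a) p)
    tileOf-initial w a p = refl
      , (λ i → trans (cell-of c a p i) (initTape-symbolAt w i p))
      , (λ i → trans (headAt-of c a p i) (0≡ᵇ p))
      where
      c = initConfig M w

    run⇒tiling : ∀ T w → AccWithin M T (initConfig M w) →
      Σ (ℕ → ℕ → MTile) λ f → Tiling tileSystem (symbolAt w) T (λ t p c → f t p ≡ c)
    run⇒tiling T w acc = (λ t p → tileOf (r t) p) , record
      { total = λ t p _ _ → _ , refl
      ; local = λ { {t} {p} refl → tileOf-local (r t) p (run-legal T _ acc t) }
      ; leftEdge = λ { refl → refl }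
      ; horizontal = λ { {t} {p} refl refl → tileOf-horizontal (r t) p }
      ; vertical = λ { {t} {p} refl refl →
          subst (λ c → Vertical (tileOf (r t) p) (tileOf (c , proj₂ (r (suc t))) p)) (sym (run-step T _ acc t))
                (tileOf-vertical (proj₁ (r t)) (proj₂ (r t)) (proj₂ (r (suc t))) p) }
      ; initial = λ { {p} refl →
          subst (λ c → Initial (symbolAt w p) (tileOf (c , proj₂ (r 0)) p)) (sym (run-start T _ acc))
                (tileOf-initial w (proj₂ (r 0)) p) }
      ; final = λ { refl → run-accepts T _ acc }
      }
      where
      r : ℕ → Snapshot
      r = run T (initConfig M w) acc

  -- From tilings to accepting runs

  module FromTiling {w T P} (tiling : Tiling tileSystem (symbolAt w) T P) where
    open Tiling tiling

    open TileSystem tileSystem using (Local; Horizontal; Vertical)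

    tileAt : ℕ → ℕ → MTile
    tileAt t p with t ≤? T | p ≤? T + T
    ... | yes t≤ | yes p≤ = proj₁ (total t p t≤ p≤)
    -- Outside the grid any tile serves as default; the one at the corner is known to exist.
    ... | _      | _      = proj₁ (total 0 0 z≤n z≤n)

    placed : ∀ {t p} → t ≤ T → p ≤ T + T → P t p (tileAt t p)
    placed {t} {p} t≤ p≤ with t ≤? T | p ≤? T + T
    ... | yes t≤′ | yes p≤′ = proj₂ (total t p t≤′ p≤′)
    ... | no t≰   | _       = ⊥-elim (t≰ t≤)
    ... | yes _   | no p≰   = ⊥-elim (p≰ p≤)

    -- Garbage may enter at the right border and travels left by at most one
    -- cell per row, so row t is only controlled up to column 2T − t.
    record Matches (t : ℕ) (c : Config M) : Set where
      field
        head≤  : ∀ i → head c i ≤ t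
        state≈ : state′ (tileAt t 0) ≡ state c
        cell≈  : ∀ {p} → p + t ≤ T + T → ∀ i → lookup (cell (tileAt t p)) i ≡ tape c i p
        headAt≈  : ∀ {p} → p + t ≤ T + T → ∀ i → lookup (headAt (tileAt t p)) i ≡ (head c i ≡ᵇ p)
    open Matches

    module Row {t} (t≤ : t ≤ T) where

      horizontal-at : ∀ {p} → suc p ≤ T + T → Horizontal (tileAt t p) (tileAt t (suc p))
      horizontal-at p≤ = horizontal (placed t≤ (<⇒≤ p≤)) (placed t≤ p≤)

      origin≡ : ∀ {p} → p ≤ T + T → origin (tileAt t p) ≡ (p ≡ᵇ 0)
      origin≡ {zero}  p≤ = leftEdge (placed t≤ p≤)
      origin≡ {suc p} p≤ = let (_ , _ , _ , e , _) = horizontal-at p≤ in e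

      reads≡ : ∀ {p} → p ≤ T + T → reads (tileAt t p) ≡ reads (tileAt t 0)
      reads≡ {zero}  p≤ = refl
      reads≡ {suc p} p≤ = let (_ , e , _) = horizontal-at p≤ in trans e (reads≡ (<⇒≤ p≤))

      action≡ : ∀ {p} → p ≤ T + T → action (tileAt t p) ≡ action (tileAt t 0)
      action≡ {zero}  p≤ = refl
      action≡ {suc p} p≤ = let (_ , _ , e , _) = horizontal-at p≤ in trans e (action≡ (<⇒≤ p≤))

      -- The guessed symbols are checked in the column `h` of the head. That column lies in the
      -- controlled region because `h ≤ t ≤ T` gives `h + t ≤ T + T`; this is what the double width
      -- of the grid is for.
      reads-match : ∀ {c} → Matches t c → reads (tileAt t 0) ≡ readSyms M c
      reads-match {c} μ = begin
        reads (tileAt t 0)                              ≡⟨ Vecₚ.tabulate∘lookup _ ⟨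
        tabulate (lookup (reads (tileAt t 0)))          ≡⟨ Vecₚ.tabulate-cong eq ⟩
        readSyms M c                                    ∎
        where
        open ≡-Reasoning
        eq : ∀ i → lookup (reads (tileAt t 0)) i ≡ tape c i (head c i)
        eq i = trans (cong (λ v → lookup v i) (sym (reads≡ h≤)))
          (trans (sym (proj₁ (proj₂ (local (placed t≤ h≤))) i
                   (trans (headAt≈ μ h+t i) (Equivalence.to Boolₚ.T-≡ (≡⇒≡ᵇ h h refl)))))
                 (cell≈ μ h+t i))
          where
          h = head c i
          h+t : h + t ≤ T + T
          h+t = +-mono-≤ (≤-trans (head≤ μ i) t≤) t≤
          h≤ : h ≤ T + T
          h≤ = m+n≤o⇒m≤o h h+t

      -- A left move looks at the neighbour on the right, so column `p` is settled after the action
      -- only if column `p + 1` was controlled before it. Hence `suc t` in the bound.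
      headAt⁺≈ : ∀ {c} → Matches t c → ∀ {p} → p + suc t ≤ T + T → ∀ i →
               lookup (headAt⁺ (tileAt t p)) i ≡ (moveHead M (move (action (tileAt t 0)) i) (head c i) ≡ᵇ p)
      headAt⁺≈ {c} μ {p} p+t< i with move (action (tileAt t 0)) i in eq
      ... | stay  = trans (proj₁ (proj₂ (proj₂ (local (placed t≤ p≤)))) i (trans (cong (λ a → move a i) (action≡ p≤)) eq))
                          (headAt≈ μ p+t≤ i)
        where
        p≤ : p ≤ T + T
        p≤ = m+n≤o⇒m≤o p p+t<
        p+t≤ : p + t ≤ T + T
        p+t≤ = ≤-trans (+-monoʳ-≤ p (n≤1+n t)) p+t<
      ... | right = moved p p+t<
        where
        moved : ∀ p → p + suc t ≤ T + T → lookup (headAt⁺ (tileAt t p)) i ≡ (suc (head c i) ≡ᵇ p)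
        moved zero    _ = proj₂ (proj₂ (proj₂ (local (placed t≤ z≤n)))) (leftEdge (placed t≤ z≤n)) i eq
        moved (suc p) le = let (_ , _ , _ , _ , r , _) = horizontal-at (m+n≤o⇒m≤o (suc p) le) in
          trans (r i (trans (cong (λ a → move a i) (action≡ (<⇒≤ (m+n≤o⇒m≤o (suc p) le)))) eq))
                (headAt≈ μ (≤-trans (+-mono-≤ (n≤1+n p) (n≤1+n t)) le) i)
      ... | left  = let (_ , _ , _ , _ , _ , l) = horizontal-at p< in
          trans (l i (trans (cong (λ a → move a i) (action≡ (<⇒≤ p<))) eq))
          (trans (cong₂ _∨_ (headAt≈ μ sp+t≤ i) (cong₂ _∧_ (origin≡ (<⇒≤ p<)) (headAt≈ μ p+t≤ i)))
                 (sym (moveLeft≡ᵇ (head c i) p)))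
        where
        sp+t≤ : suc p + t ≤ T + T
        sp+t≤ = subst (_≤ T + T) (+-suc p t) p+t<
        p< : suc p ≤ T + T
        p< = m+n≤o⇒m≤o (suc p) sp+t≤
        p+t≤ : p + t ≤ T + T
        p+t≤ = <⇒≤ sp+t≤

    matches-start : Matches 0 (initConfig M w)
    matches-start = record
      { head≤ = λ _ → z≤n
      ; state≈ = proj₁ (initial (placed z≤n z≤n))
      ; cell≈ = λ {p} le i → trans (proj₁ (proj₂ (initial (placed z≤n (p≤ le)))) i) (sym (initTape-symbolAt w i p))
      ; headAt≈ = λ {p} le i → trans (proj₂ (proj₂ (initial (placed z≤n (p≤ le)))) i)
                  (trans (Row.origin≡ z≤n (p≤ le)) (sym (0≡ᵇ p)))
      }
      where
      p≤ : ∀ {p} → p + 0 ≤ T + T → p ≤ T + T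
      p≤ {p} = m+n≤o⇒m≤o p

    moveHead-≤ : ∀ x {h t} → h ≤ t → moveHead M x h ≤ suc t
    moveHead-≤ left  {zero}  h≤ = z≤n
    moveHead-≤ left  {suc h} h≤ = m≤n⇒m≤1+n (<⇒≤ h≤)
    moveHead-≤ stay          h≤ = m≤n⇒m≤1+n h≤
    moveHead-≤ right         h≤ = s≤s h≤

    matches-next : ∀ {t c q′ ws ms} → suc t ≤ T → Matches t c →
                   action (tileAt t 0) ≡ just (q′ , ws , ms) → Matches (suc t) (next M c q′ ws ms)
    matches-next {t} {c} {q′} {ws} {ms} t< μ eq = record
      { head≤ = λ i → moveHead-≤ (lookup ms i) (head≤ μ i)
      ; state≈ = trans (proj₁ (vertical-at z≤n)) (cong (λ a → target a (state′ (tileAt t 0))) eq)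
      ; cell≈ = λ {p} le i → trans (proj₁ (proj₂ (vertical-at (p≤ le))) i)
          (trans (cong₂ (λ x y → if x then written (action (tileAt t p)) (reads (tileAt t p)) i else y)
                        (headAt≈ μ (p+t≤ le) i) (cell≈ μ (p+t≤ le) i))
          (trans (cong (λ a → if head c i ≡ᵇ p then written a (reads (tileAt t p)) i else tape c i p)
                       (trans (action≡ (p≤ le)) eq))
          (sym (writeCell-if (tape c i) (head c i) (lookup ws i) p))))
      ; headAt≈ = λ {p} le i → trans (proj₂ (proj₂ (vertical-at (p≤ le))) i)
          (trans (headAt⁺≈ μ le i) (cong (λ a → moveHead M (move a i) (head c i) ≡ᵇ p) eq))
      }
      where
      open Row (<⇒≤ t<)
      vertical-at : ∀ {p} → p ≤ T + T → Vertical (tileAt t p) (tileAt (suc t) p)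
      vertical-at p≤ = vertical (placed (<⇒≤ t<) p≤) (placed t< p≤)
      p≤ : ∀ {p} → p + suc t ≤ T + T → p ≤ T + T
      p≤ {p} = m+n≤o⇒m≤o p
      p+t≤ : ∀ {p} → p + suc t ≤ T + T → p + t ≤ T + T
      p+t≤ {p} = ≤-trans (+-monoʳ-≤ p (n≤1+n t))

    -- The actions written in column 0 dictate the run. It ends at the first idle row or, with no
    -- steps left, at row `T`, where `Final` applies.
    accepts : ∀ s {t c} → t + s ≡ T → Matches t c → AccWithin M s c
    accepts zero {t} {c} t≡T μ = trans (sym (state≈ μ)) (final (subst (λ x → P x 0 (tileAt t 0)) t≡ (placed t≤ z≤n)))
      where
      t≡ : t ≡ T
      t≡ = trans (sym (+-identityʳ t)) t≡T
      t≤ : t ≤ T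
      t≤ = ≤-reflexive t≡
    accepts (suc s) {t} {c} t+s μ = go (action (tileAt t 0)) refl (proj₁ (local (placed (<⇒≤ t<) z≤n)))
      where
      t+s′ : suc t + s ≡ T
      t+s′ = trans (sym (+-suc t s)) t+s
      t< : suc t ≤ T
      t< = subst (suc t ≤_) t+s′ (m≤m+n (suc t) s)
      go : ∀ a → action (tileAt t 0) ≡ a →
           Legal (state′ (tileAt t 0)) (reads (tileAt t 0)) (action (tileAt t 0)) → AccWithin M (suc s) c
      -- Idling is legal only in the accepting state.
      go nothing eq ok = inj₁ (trans (sym (state≈ μ)) (subst (Legal _ _) eq ok))
      go (just (q′ , ws , ms)) eq ok = inj₂ (q′ , ws , ms
        , trans (cong₂ (λ q r → δ q r q′ ws ms) (sym (state≈ μ)) (sym (Row.reads-match (<⇒≤ t<) μ)))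
                (subst (Legal _ _) eq ok)
        , accepts s t+s′ (matches-next t< μ eq))

  tiling⇒run : ∀ {T w P} → Tiling tileSystem (symbolAt w) T P → AccWithin M T (initConfig M w)
  tiling⇒run {T} {w} tiling = accepts T refl matches-start
    where open FromTiling {w} tiling

-- Binary representations

bit : Bool → ℕ
bit false = 0
bit true  = 1

bit-parity : ∀ b m → ((bit b + m * 2) % 2 ≡ᵇ 1) ≡ b
bit-parity false m = cong (_≡ᵇ 1) ([m+kn]%n≡m%n 0 m 2)
bit-parity true  m = cong (_≡ᵇ 1) ([m+kn]%n≡m%n 1 m 2)

bit-half : ∀ b m → (bit b + m * 2) / 2 ≡ m
bit-half b m = trans (+-distrib-/-∣ʳ (bit b) (divides m refl)) (trans (cong₂ _+_ (bit/2 b) (m*n/n≡m m 2)) refl)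
  where
  bit/2 : ∀ b → bit b / 2 ≡ 0
  bit/2 false = refl
  bit/2 true  = refl

bit-parity-half : ∀ n → n ≡ bit (n % 2 ≡ᵇ 1) + n / 2 * 2
bit-parity-half n = trans (m≡m%n+[m/n]*n n 2) (cong (_+ n / 2 * 2) (lem (n % 2) (m%n<n n 2)))
  where
  lem : ∀ r → r < 2 → r ≡ bit (r ≡ᵇ 1)
  lem 0 _ = refl
  lem 1 _ = refl
  lem (suc (suc r)) (s≤s (s≤s ()))

half-bound : ∀ {m f} → suc m ≤ suc f → suc m / 2 ≤ f
half-bound {m} le = ≤-pred (≤-trans (m/n<m (suc m) 2 (s≤s (s≤s z≤n))) le)

-- `binary` starts with fuel equal to its argument, whereas the recursive call on the half has fuel
-- to spare; this reconciles the two.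
lsbDigits-fuel : ∀ {f g} m → m ≤ f → m ≤ g → lsbDigits f m ≡ lsbDigits g m
lsbDigits-fuel {zero}  {zero}  zero    _ _ = refl
lsbDigits-fuel {zero}  {suc g} zero    _ _ = refl
lsbDigits-fuel {suc f} {zero}  zero    _ _ = refl
lsbDigits-fuel {suc f} {suc g} zero    _ _ = refl
lsbDigits-fuel {suc f} {suc g} (suc m) p q =
  cong ((suc m % 2 ≡ᵇ 1) ∷_) (lsbDigits-fuel (suc m / 2) (half-bound p) (half-bound q))

binary-suc : ∀ n → binary (suc n) ≡ binary (suc n / 2) ∷ʳ (suc n % 2 ≡ᵇ 1)
binary-suc n = trans (Listₚ.unfold-reverse _ (lsbDigits n (suc n / 2)))
  (cong (λ l → reverse l ∷ʳ (suc n % 2 ≡ᵇ 1)) (lsbDigits-fuel {n} (suc n / 2) (half-bound ≤-refl) ≤-refl))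

-- Positivity of `suc m` matters: zero is written as the empty word, so appending the digit 0 to it
-- would not give the word of twice zero.
binary-bit : ∀ b m → binary (bit b + suc m * 2) ≡ binary (suc m) ∷ʳ b
binary-bit b m = trans (lem b) (cong₂ (λ n c → binary n ∷ʳ c) (bit-half b (suc m)) (bit-parity b (suc m)))
  where
  lem : ∀ b → binary (bit b + suc m * 2)
            ≡ binary ((bit b + suc m * 2) / 2) ∷ʳ ((bit b + suc m * 2) % 2 ≡ᵇ 1)
  lem false = binary-suc (suc (m * 2))
  lem true  = binary-suc (suc (suc (m * 2)))

valueLsb : List Bool → ℕ
valueLsb []      = 0
valueLsb (b ∷ l) = bit b + valueLsb l * 2

valueLsb-lsbDigits : ∀ {f} m → m ≤ f → valueLsb (lsbDigits f m) ≡ m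
valueLsb-lsbDigits {zero}  zero    _  = refl
valueLsb-lsbDigits {suc f} zero    _  = refl
valueLsb-lsbDigits {suc f} (suc m) le =
  trans (cong (λ v → bit (suc m % 2 ≡ᵇ 1) + v * 2) (valueLsb-lsbDigits (suc m / 2) (half-bound le)))
        (sym (bit-parity-half (suc m)))

binary-injective : ∀ {m n} → binary m ≡ binary n → m ≡ n
binary-injective {m} {n} e = begin
  m                          ≡⟨ valueLsb-lsbDigits m ≤-refl ⟨
  valueLsb (lsbDigits m m)   ≡⟨ cong valueLsb (Listₚ.reverse-injective {x = lsbDigits m m} {lsbDigits n n} e) ⟩
  valueLsb (lsbDigits n n)   ≡⟨ valueLsb-lsbDigits n ≤-refl ⟩
  n                          ∎
  where open ≡-Reasoning

length-binary : ∀ n → length (binary n) ≡ length (lsbDigits n n)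
length-binary n = Listₚ.length-reverse (lsbDigits n n)

length-binary-suc : ∀ n → length (binary (suc n)) ≡ suc (pred (length (binary (suc n))))
length-binary-suc n rewrite length-binary (suc n) = refl

<2^length-lsb : ∀ l → valueLsb l < 2 ^ length l
<2^length-lsb []      = s≤s z≤n
<2^length-lsb (b ∷ l) = begin-strict
  bit b + valueLsb l * 2          <⟨ +-monoˡ-< (valueLsb l * 2) (bit<2 b) ⟩
  2 + valueLsb l * 2              ≤⟨ *-monoˡ-≤ 2 (<2^length-lsb l) ⟩
  2 ^ length l * 2                ≡⟨ *-comm (2 ^ length l) 2 ⟩
  2 ^ suc (length l)              ∎
  where
  open ≤-Reasoning
  bit<2 : ∀ b → bit b < 2
  bit<2 false = s≤s z≤n
  bit<2 true  = s≤s (s≤s z≤n)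

2^length-lsb : ∀ f m → suc m ≤ f → 2 ^ length (lsbDigits f (suc m)) ≤ 2 * suc m
2^length-lsb (suc f) m le = *-monoʳ-≤ 2 (lem (suc m / 2) refl)
  where
  -- The half is abstracted because the induction only covers positive numbers; when it is zero, no
  -- further digit follows and the power is 1.
  lem : ∀ h → suc m / 2 ≡ h → 2 ^ length (lsbDigits f h) ≤ suc m
  lem zero    e = subst (λ l → 2 ^ length l ≤ suc m) (lsbDigits-fuel {0} {f} 0 z≤n z≤n) (s≤s z≤n)
  lem (suc h) e = begin
    2 ^ length (lsbDigits f (suc h))           ≤⟨ 2^length-lsb f h (subst (_≤ f) e (half-bound le)) ⟩
    2 * suc h                                  ≡⟨ *-comm 2 (suc h) ⟩
    suc h * 2                                  ≡⟨ cong (_* 2) e ⟨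
    suc m / 2 * 2                              ≤⟨ m/n*n≤m (suc m) 2 ⟩
    suc m                                      ∎
    where open ≤-Reasoning

-- The integer part of the binary logarithm for positive `n`, so that `2 ^ level N` is the base of
-- the digits.
level : ℕ → ℕ
level n = pred (length (binary n))

length≡suc-level : ∀ {n} → 1 ≤ n → length (binary n) ≡ suc (level n)
length≡suc-level {suc n} _ = length-binary-suc n

2^level≤ : ∀ {n} → 1 ≤ n → 2 ^ level n ≤ n
2^level≤ {suc n} 1≤n = *-cancelˡ-≤ 2 (begin
  2 ^ suc (level (suc n))                       ≡⟨ cong (2 ^_) (length≡suc-level 1≤n) ⟨
  2 ^ length (binary (suc n))                   ≡⟨ cong (2 ^_) (length-binary (suc n)) ⟩
  2 ^ length (lsbDigits (suc n) (suc n))        ≤⟨ 2^length-lsb (suc n) n ≤-refl ⟩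
  2 * suc n                                     ∎)
  where open ≤-Reasoning

<2^suc-level : ∀ {n} → 1 ≤ n → n < 2 ^ suc (level n)
<2^suc-level {n} 1≤n = begin-strict
  n                                  ≡⟨ valueLsb-lsbDigits n ≤-refl ⟨
  valueLsb (lsbDigits n n)           <⟨ <2^length-lsb (lsbDigits n n) ⟩
  2 ^ length (lsbDigits n n)         ≡⟨ cong (2 ^_) (length-binary n) ⟨
  2 ^ length (binary n)              ≡⟨ cong (2 ^_) (length≡suc-level 1≤n) ⟩
  2 ^ suc (level n)                  ∎
  where open ≤-Reasoning

n<2^n : ∀ n → n < 2 ^ n
n<2^n zero    = s≤s z≤n
n<2^n (suc n) = begin-strict
  suc n          <⟨ s≤s (n<2^n n) ⟩
  1 + 2 ^ n      ≤⟨ +-monoˡ-≤ (2 ^ n) (m^n>0 2 n) ⟩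
  2 ^ n + 2 ^ n  ≡⟨ cong (2 ^ n +_) (+-identityʳ (2 ^ n)) ⟨
  2 ^ suc n      ∎
  where open ≤-Reasoning

-- Consequently every input position is smaller than the base and fits into the lowest column digit;
-- `InputBit` depends on it.
length≤2^level : ∀ {n} → 1 ≤ n → length (binary n) ≤ 2 ^ level n
length≤2^level {n} 1≤n = subst (_≤ 2 ^ level n) (sym (length≡suc-level 1≤n)) (n<2^n (level n))

2^-bracket-unique : ∀ {i j n} → 2 ^ i ≤ n → n < 2 ^ suc i → 2 ^ j ≤ n → n < 2 ^ suc j → i ≡ j
2^-bracket-unique {i} {j} i≤ <i j≤ <j with <-cmp i j
... | tri≈ _ i≡j _ = i≡j
... | tri< i<j _ _ = ⊥-elim (<⇒≱ <i (≤-trans (^-monoʳ-≤ 2 i<j) j≤))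
... | tri> _ _ j<i = ⊥-elim (<⇒≱ <j (≤-trans (^-monoʳ-≤ 2 j<i) i≤))

symbolAt-∷ʳ : ∀ w b j c → symbolAt (w ∷ʳ b) j ≡ just c ⇔ (symbolAt w j ≡ just c ⊎ (j ≡ length w × b ≡ c))
symbolAt-∷ʳ []      b zero    c = mk⇔ (λ e → inj₂ (refl , Maybeₚ.just-injective e)) λ { (inj₂ (_ , refl)) → refl }
symbolAt-∷ʳ []      b (suc j) c = mk⇔ (λ ()) λ { (inj₁ ()) ; (inj₂ ()) }
symbolAt-∷ʳ (a ∷ w) b zero    c = mk⇔ inj₁ λ { (inj₁ e) → e ; (inj₂ ()) }
symbolAt-∷ʳ (a ∷ w) b (suc j) c = mk⇔
  (λ e → Sum.map₂ (map₁ (cong suc)) (to (symbolAt-∷ʳ w b j c) e))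
  (λ e → from (symbolAt-∷ʳ w b j c) (Sum.map₂ (map₁ suc-injective) e))

symbolAt-<⁺ : ∀ {w j} → j < length w → Σ Bool λ c → symbolAt w j ≡ just c
symbolAt-<⁺ {a ∷ w} {zero}  _        = a , refl
symbolAt-<⁺ {a ∷ w} {suc j} (s≤s j<) = symbolAt-<⁺ {w} j<

symbolAt-<⁻ : ∀ w {j c} → symbolAt w j ≡ just c → j < length w
symbolAt-<⁻ (a ∷ w) {zero}  _ = s≤s z≤n
symbolAt-<⁻ (a ∷ w) {suc j} e = s≤s (symbolAt-<⁻ w e)

-- Element e of the universe {0, …, N−1} stands for the number e + 1.
word : ℕ → List Bool
word e = binary (suc e)

-- In terms of the number n = e + 1 that `e` stands for, this is the element of 2n + b, whose word
-- is that of n with `b` appended. In particular `child false` is doubling.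
child : Bool → ℕ → ℕ
child b e = suc (bit b + e * 2)

word-child : ∀ b e → word (child b e) ≡ word e ∷ʳ b
word-child false e = binary-bit false e
word-child true  e = binary-bit true e

unchild : ∀ e → Σ Bool λ b → Σ ℕ λ c → suc e ≡ child b c
unchild e = _ , e / 2 , cong suc (bit-parity-half e)

<child : ∀ b e → e < child b e
<child b e = s≤s (≤-trans (m≤m*n e 2) (m≤n+m (e * 2) (bit b)))

-- Order and arithmetic on the universe

-- Pigeonhole: if `i` were missed, punching it out would inject `Fin (suc n)` into `Fin n`.
injective⇒surjective : ∀ {n} (f : Fin n → Fin n) → (∀ {a b} → f a ≡ f b → a ≡ b) →
                       ∀ i → Σ (Fin n) λ a → f a ≡ i
injective⇒surjective {suc n} f inj i with any? (λ a → f a ≟F i)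
... | yes hit = hit
... | no miss = ⊥-elim (<-irrefl refl (injective⇒≤ {f = g} g-inj))
  where
  i≢f : ∀ a → i ≢ f a
  i≢f a e = miss (a , sym e)
  g : Fin (suc n) → Fin n
  g a = punchOut (i≢f a)
  g-inj : ∀ {a b} → g a ≡ g b → a ≡ b
  g-inj {a} {b} e = inj (punchOut-injective (i≢f a) (i≢f b) e)

-- An order isomorphism with the natural numbers below `N`, kept abstract so that the same lemmas
-- apply to an arbitrary model of the axioms and to the model built on `toℕ`.
record Ranking {N : ℕ} (lt : Fin N → Fin N → Set) : Set where
  field
    rk        : Fin N → ℕ
    rk<       : ∀ a → rk a < N
    rk-inj    : ∀ {a b} → rk a ≡ rk b → a ≡ b
    element   : ∀ {i} → i < N → Σ (Fin N) λ a → rk a ≡ i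
    lt⇔       : ∀ {a b} → lt a b ⇔ rk a < rk b

module LinearOrder {N : ℕ} (lt : Fin N → Fin N → Bool)
  (lt-irrefl : ∀ a → ¬ lt a a ≡ true)
  (lt-trans  : ∀ a b c → lt a b ≡ true → lt b c ≡ true → lt a c ≡ true)
  (lt-total  : ∀ a b → lt a b ≡ true ⊎ a ≡ b ⊎ lt b a ≡ true) where

  below : Fin N → Subset N
  below a = tabulate (λ b → lt b a)

  below⁺ : ∀ {a b} → lt b a ≡ true → b ∈S below a
  below⁺ {a} {b} h = Vecₚ.lookup⇒[]= b (below a) (trans (Vecₚ.lookup∘tabulate (λ b → lt b a) b) h)

  below⁻ : ∀ {a b} → b ∈S below a → lt b a ≡ true
  below⁻ {a} {b} h = trans (sym (Vecₚ.lookup∘tabulate (λ b → lt b a) b)) (Vecₚ.[]=⇒lookup h)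

  -- Counting predecessors is strictly monotone, hence injective by totality of the order, hence
  -- onto the numbers below `N` by finiteness.
  rank : Fin N → ℕ
  rank a = ∣ below a ∣

  rank-mono : ∀ {a b} → lt a b ≡ true → rank a < rank b
  rank-mono {a} {b} h = p⊂q⇒∣p∣<∣q∣
    ((λ {c} c∈ → below⁺ (lt-trans c a b (below⁻ c∈) h)) , a , below⁺ h , lt-irrefl a ∘ below⁻)

  rank<N : ∀ a → rank a < N
  rank<N a = subst (rank a <_) (∣⊤∣≡n N) (p⊂q⇒∣p∣<∣q∣ ((λ _ → ∈⊤) , a , ∈⊤ , lt-irrefl a ∘ below⁻))

  rank-inj : ∀ {a b} → rank a ≡ rank b → a ≡ b
  rank-inj {a} {b} e with lt-total a b
  ... | inj₁ h        = ⊥-elim (<-irrefl e (rank-mono h))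
  ... | inj₂ (inj₁ p) = p
  ... | inj₂ (inj₂ h) = ⊥-elim (<-irrefl (sym e) (rank-mono h))

  rank-reflect : ∀ {a b} → rank a < rank b → lt a b ≡ true
  rank-reflect {a} {b} h with lt-total a b
  ... | inj₁ q           = q
  ... | inj₂ (inj₁ refl) = ⊥-elim (<-irrefl refl h)
  ... | inj₂ (inj₂ q)    = ⊥-elim (<-asym h (rank-mono q))

  rankFin : Fin N → Fin N
  rankFin a = fromℕ< (rank<N a)

  rank-element : ∀ {i} → i < N → Σ (Fin N) λ a → rank a ≡ i
  rank-element i<N =
    let (a , e) = injective⇒surjective rankFin rankFin-inj (fromℕ< i<N)
    in a , trans (sym (toℕ-fromℕ< (rank<N a))) (trans (cong toℕ e) (toℕ-fromℕ< i<N))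
    where
    rankFin-inj : ∀ {a b} → rankFin a ≡ rankFin b → a ≡ b
    rankFin-inj {a} {b} e = rank-inj
      (trans (sym (toℕ-fromℕ< (rank<N a))) (trans (cong toℕ e) (toℕ-fromℕ< (rank<N b))))

  ranking : Ranking (λ a b → lt a b ≡ true)
  ranking = record { rk = rank ; rk< = rank<N ; rk-inj = rank-inj ; element = rank-element
                   ; lt⇔ = mk⇔ rank-mono rank-reflect }

pattern LT      = fz
pattern SUC     = fs fz
pattern DBL     = fs (fs fz)
pattern DIGIT0  = fs (fs (fs fz))
pattern DIGIT1  = fs (fs (fs (fs fz)))
pattern POW     = fs (fs (fs (fs (fs fz))))
pattern TOP     = fs (fs (fs (fs (fs (fs fz)))))
pattern COLOR i = fs (fs (fs (fs (fs (fs (fs i))))))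

-- Defining axioms for arithmetic in three variables

module Arithmetic (nCol arCol : ℕ) where

  arityOf : Fin (7 + nCol) → ℕ
  arityOf LT        = 2
  arityOf SUC       = 2
  arityOf DBL       = 2
  arityOf DIGIT0    = 2
  arityOf DIGIT1    = 2
  arityOf POW       = 1
  arityOf TOP       = 1
  arityOf (COLOR _) = arCol

  vocab : Vocab
  vocab = record { nrel = 7 + nCol ; arity = arityOf }

  module _ {j : ℕ} where

    Φ : Set
    Φ = Formula vocab (3 + j)

    Lt Suc Dbl : Fin (3 + j) → Fin (3 + j) → Φ
    Lt  u v = rel LT (u ∷ v ∷ [])
    Suc u v = rel SUC (u ∷ v ∷ [])
    Dbl u v = rel DBL (u ∷ v ∷ [])

    Digit : Bool → Fin (3 + j) → Fin (3 + j) → Φ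
    Digit false u v = rel DIGIT0 (u ∷ v ∷ [])
    Digit true  u v = rel DIGIT1 (u ∷ v ∷ [])

    Pow Top : Fin (3 + j) → Φ
    Pow u = rel POW (u ∷ [])
    Top u = rel TOP (u ∷ [])

    pattern x = fz
    pattern y = fs fz
    pattern z = fs (fs fz)

    -- via must differ from u
    Least : Fin (3 + j) → Fin (3 + j) → Φ
    Least via u = ¬' ∃' via (Lt via u)

    -- Elements stand for their rank plus one. Doubling thus starts with 1 ↦ 2 and continues with
    -- 2(n + 1) = 2n + 2. Stepping back twice from `y` would call for fresh variables; instead `x`
    -- and `y` are requantified once their old values are no longer needed. `topBody` singles out
    -- the largest power of two in the universe as the one without a double.
    sucBody dblBody powBody topBody : Φ
    sucBody = Lt x y ∧' (¬' ∃' z (Lt x z ∧' Lt z y))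
    dblBody = (Least z x ∧' Suc x y) ∨' ∃' z (Suc z x ∧' ∃' x (Suc x y ∧' ∃' y (Suc y x ∧' Dbl z y)))
    powBody = Least z x ∨' ∃' z (Pow z ∧' Dbl z x)
    topBody = Pow x ∧' (¬' ∃' z (Dbl x z))

    Child : Bool → Φ
    Child false = Dbl z y
    Child true  = ∃' x (Dbl z x ∧' Suc x y)

    -- position x is the first one after the word of z
    End : Φ
    End = (¬' (Digit false x z ∨' Digit true x z)) ∧' ∃' y (Suc y x ∧' (Digit false y z ∨' Digit true y z))

    digitBase : Bool → Φ
    digitBase false = ⊥'
    digitBase true  = Least z y ∧' Least z x

    -- Recursion on the word of `y`: it is the one-digit word of 1, or the word of some `z` with one
    -- digit appended. A digit at `x` is then inherited from `z` or is the appended one.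
    digitBody : Bool → Φ
    digitBody b = digitBase b ∨' (∃' z ((Child false ∨' Child true) ∧' Digit b x z) ∨' ∃' z (Child b ∧' End))

    theory : Φ
    theory = (¬' Lt x x)
          ∧' ((Lt x y ∧' Lt y z ⇒' Lt x z)
          ∧' ((Lt x y ∨' ((x ≐ y) ∨' Lt y x))
          ∧' ((Suc x y ⇔' sucBody)
          ∧' ((Dbl x y ⇔' dblBody)
          ∧' ((Digit false x y ⇔' digitBody false)
          ∧' ((Digit true x y ⇔' digitBody true)
          ∧' ((Pow x ⇔' powBody)
          ∧' (Top x ⇔' topBody))))))))

  -- Models of the axioms are exactly the standard ones

  module Semantics {N : ℕ} (𝔐 : Structure vocab N) where

    LtM SucM DblM : Fin N → Fin N → Set
    LtM a b  = 𝔐 LT (a ∷ b ∷ []) ≡ true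
    SucM a b = 𝔐 SUC (a ∷ b ∷ []) ≡ true
    DblM a b = 𝔐 DBL (a ∷ b ∷ []) ≡ true

    DigitM : Bool → Fin N → Fin N → Set
    DigitM false a b = 𝔐 DIGIT0 (a ∷ b ∷ []) ≡ true
    DigitM true  a b = 𝔐 DIGIT1 (a ∷ b ∷ []) ≡ true

    PowM TopM : Fin N → Set
    PowM a = 𝔐 POW (a ∷ []) ≡ true
    TopM a = 𝔐 TOP (a ∷ []) ≡ true

    record Standard : Set where
      field
        ranking : Ranking LtM
      open Ranking ranking public
      field
        suc⇔   : ∀ {a b} → SucM a b ⇔ rk b ≡ suc (rk a)
        dbl⇔   : ∀ {a b} → DblM a b ⇔ rk b ≡ child false (rk a)
        digit⇔ : ∀ c {a b} → DigitM c a b ⇔ symbolAt (word (rk b)) (rk a) ≡ just c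
        pow⇔   : ∀ {a} → PowM a ⇔ Σ ℕ λ i → suc (rk a) ≡ 2 ^ i
        top⇔   : ∀ {a} → TopM a ⇔ suc (rk a) ≡ 2 ^ level N

    module _ {j : ℕ} where

      Env : Set
      Env = Fin (3 + j) → Fin N

      -- The defining axioms have at most the first two variables free, so the remaining values can
      -- be arbitrary.
      env : Fin N → Fin N → Env
      env a b x = a
      env a b (fs _) = b

      Digit⇔ : ∀ (ρ : Env) b u v → Sat 𝔐 ρ (Digit b u v) ⇔ DigitM b (ρ u) (ρ v)
      Digit⇔ ρ false u v = mk⇔ id id
      Digit⇔ ρ true  u v = mk⇔ id id

      module Order (ranking : Ranking LtM) where
        open Ranking ranking

        sucBody⇔ : ∀ (ρ : Env) → Sat 𝔐 ρ sucBody ⇔ rk (ρ y) ≡ suc (rk (ρ x))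
        sucBody⇔ ρ = mk⇔ ⇒ ⇐
          where
          ⇒ : Sat 𝔐 ρ sucBody → rk (ρ y) ≡ suc (rk (ρ x))
          ⇒ (a<b , none) with m≤n⇒m<n∨m≡n (to lt⇔ a<b)
          ... | inj₂ e = sym e
          ... | inj₁ l = let (c , e) = element (<-trans l (rk< (ρ y))) in
            ⊥-elim (none (c , from lt⇔ (≤-reflexive (sym e)) , from lt⇔ (subst (_< rk (ρ y)) (sym e) l)))
          ⇐ : rk (ρ y) ≡ suc (rk (ρ x)) → Sat 𝔐 ρ sucBody
          ⇐ e = from lt⇔ (≤-reflexive (sym e)) , λ (c , a<c , c<b) →
            <-irrefl refl (≤-trans (s≤s (to lt⇔ a<c)) (subst (rk c <_) e (to lt⇔ c<b)))

        least⇔ : ∀ {a} → (¬ Σ (Fin N) λ c → LtM c a) ⇔ rk a ≡ 0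
        least⇔ {a} = mk⇔
          (λ none → n≤0⇒n≡0 (≮⇒≥ λ 0<a → let (c , e) = element (<-trans 0<a (rk< a)) in
             none (c , from lt⇔ (subst (_< rk a) (sym e) 0<a))))
          (λ e (c , c<a) → n≮0 (subst (rk c <_) e (to lt⇔ c<a)))

        predecessor : ∀ {a i} → rk a ≡ suc i → Σ (Fin N) λ c → rk c ≡ i
        predecessor {a} e = element (<-trans (≤-reflexive (sym e)) (rk< a))

        module Successor (suc⇔ : ∀ {a b} → SucM a b ⇔ rk b ≡ suc (rk a)) where

          -- The body mentions `DBL` only at the predecessor of `x`, so knowledge below `ρ x`
          -- suffices. This restricted hypothesis lets one lemma both verify the axiom in the
          -- standard interpretation and drive the induction showing that no other interpretation
          -- satisfies it. `powBody⇔` and `digitBody⇔` follow the same plan.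
          dblBody⇔ : ∀ (ρ : Env) →
            (∀ {c b} → rk c < rk (ρ x) → DblM c b ⇔ rk b ≡ child false (rk c)) →
            Sat 𝔐 ρ dblBody ⇔ rk (ρ y) ≡ child false (rk (ρ x))
          dblBody⇔ ρ ih = mk⇔ ⇒ (⇐ _ refl)
            where
            ⇒ : Sat 𝔐 ρ dblBody → rk (ρ y) ≡ child false (rk (ρ x))
            ⇒ (inj₁ (least , s)) = trans (to suc⇔ s) (cong suc
              (trans (to least⇔ least) (cong (_* 2) (sym (to least⇔ least)))))
            ⇒ (inj₂ (c , c⋖x , x′ , x′⋖y , y′ , y′⋖x′ , d)) = begin
              rk (ρ y)                    ≡⟨ to suc⇔ x′⋖y ⟩
              suc (rk x′)                 ≡⟨ cong suc (to suc⇔ y′⋖x′) ⟩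
              2 + rk y′                   ≡⟨ cong (2 +_) (to (ih (≤-reflexive (sym (to suc⇔ c⋖x)))) d) ⟩
              suc (suc (rk c) * 2)        ≡⟨ cong (λ r → suc (r * 2)) (to suc⇔ c⋖x) ⟨
              suc (rk (ρ x) * 2)          ∎
              where open ≡-Reasoning
            ⇐ : ∀ i → rk (ρ x) ≡ i → rk (ρ y) ≡ child false (rk (ρ x)) → Sat 𝔐 ρ dblBody
            ⇐ zero x≡ e = inj₁ (from least⇔ x≡ , from suc⇔ (trans e (cong suc (trans (cong (_* 2) x≡) (sym x≡)))))
            ⇐ (suc i) x≡ e =
              let (c , c≡)   = predecessor x≡
                  y≡         = trans e (cong (λ r → suc (r * 2)) x≡)
                  (x′ , x′≡) = predecessor y≡
                  (y′ , y′≡) = predecessor x′≡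
              in inj₂ (c , from suc⇔ (trans x≡ (cong suc (sym c≡)))
                     , x′ , from suc⇔ (trans y≡ (cong suc (sym x′≡)))
                     , y′ , from suc⇔ (trans x′≡ (cong suc (sym y′≡)))
                     , from (ih (≤-reflexive (trans (cong suc c≡) (sym x≡))))
                            (trans y′≡ (cong (λ r → suc (r * 2)) (sym c≡))))

          module Doubling (dbl⇔ : ∀ {a b} → DblM a b ⇔ rk b ≡ child false (rk a)) where

            child⇔ : ∀ (ρ : Env) b → Sat 𝔐 ρ (Child b) ⇔ rk (ρ y) ≡ child b (rk (ρ z))
            child⇔ ρ false = dbl⇔
            child⇔ ρ true  = mk⇔
              (λ (a , d , s) → trans (to suc⇔ s) (cong suc (to dbl⇔ d)))
              (λ e → let (a , a≡) = predecessor e in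
                 a , from dbl⇔ a≡ , from suc⇔ (trans e (cong suc (sym a≡))))

            powBody⇔ : ∀ (ρ : Env) →
              (∀ {c} → rk c < rk (ρ x) → PowM c ⇔ Σ ℕ λ i → suc (rk c) ≡ 2 ^ i) →
              Sat 𝔐 ρ powBody ⇔ Σ ℕ λ i → suc (rk (ρ x)) ≡ 2 ^ i
            powBody⇔ ρ ih = mk⇔ ⇒ ⇐
              where
              ⇒ : Sat 𝔐 ρ powBody → Σ ℕ λ i → suc (rk (ρ x)) ≡ 2 ^ i
              ⇒ (inj₁ least) = 0 , cong suc (to least⇔ least)
              ⇒ (inj₂ (c , p , d)) =
                let x≡ = to dbl⇔ d
                    (i , e) = to (ih (subst (rk c <_) (sym x≡) (<child false (rk c)))) p
                in suc i , trans (cong suc x≡) (trans (cong (_* 2) e) (*-comm (2 ^ i) 2))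
              ⇐ : (Σ ℕ λ i → suc (rk (ρ x)) ≡ 2 ^ i) → Sat 𝔐 ρ powBody
              ⇐ (zero , e)  = inj₁ (from least⇔ (suc-injective e))
              ⇐ (suc i , e) =
                let i⁻ = pred (2 ^ i)
                    2^i≡ : suc i⁻ ≡ 2 ^ i
                    2^i≡ = suc-pred (2 ^ i) {{m^n≢0 2 i}}
                    x≡ : rk (ρ x) ≡ child false i⁻
                    x≡ = suc-injective (trans e (trans (*-comm 2 (2 ^ i)) (cong (_* 2) (sym 2^i≡))))
                    (c , c≡) = element (<-trans (subst (i⁻ <_) (sym x≡) (<child false i⁻)) (rk< (ρ x)))
                in inj₂ (c , from (ih (subst₂ _<_ (sym c≡) (sym x≡) (<child false i⁻))) (i , trans (cong suc c≡) 2^i≡)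
                           , from dbl⇔ (trans x≡ (cong (child false) (sym c≡))))

            topBody⇔ : ∀ (ρ : Env) → (∀ {a} → PowM a ⇔ Σ ℕ λ i → suc (rk a) ≡ 2 ^ i) →
              Sat 𝔐 ρ topBody ⇔ suc (rk (ρ x)) ≡ 2 ^ level N
            topBody⇔ ρ pow⇔ = mk⇔ ⇒ ⇐
              where
              1≤N : 1 ≤ N
              1≤N = ≤-trans (s≤s z≤n) (rk< (ρ x))
              ⇒ : Sat 𝔐 ρ topBody → suc (rk (ρ x)) ≡ 2 ^ level N
              ⇒ (p , none) = let (i , e) = to pow⇔ p in
                trans e (cong (2 ^_) (2^-bracket-unique {i} {level N} {N} (subst (_≤ N) e (rk< (ρ x))) (N< i e) (2^level≤ 1≤N) (<2^suc-level 1≤N)))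
                where
                -- If the double were at most `N`, the universe would contain its element,
                -- contradicting `none`.
                N< : ∀ i → suc (rk (ρ x)) ≡ 2 ^ i → N < 2 ^ suc i
                N< i e = subst (N <_) (trans (cong (_* 2) e) (*-comm (2 ^ i) 2))
                  (s≤s (≮⇒≥ λ l → let (c , c≡) = element l in none (c , from dbl⇔ c≡)))
              ⇐ : suc (rk (ρ x)) ≡ 2 ^ level N → Sat 𝔐 ρ topBody
              ⇐ e = from pow⇔ (level N , e) , λ (c , d) →
                <⇒≱ (<2^suc-level 1≤N)
                    (subst (_≤ N) (trans (cong suc (to dbl⇔ d)) (trans (cong (_* 2) e) (*-comm (2 ^ level N) 2))) (rk< c))

            module Digits (ρ : Env)
              (ih : ∀ c {a b} → rk b < rk (ρ y) → DigitM c a b ⇔ symbolAt (word (rk b)) (rk a) ≡ just c) where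

              anyDigit⇔ : ∀ (ρ′ : Env) u v → rk (ρ′ v) < rk (ρ y) →
                Sat 𝔐 ρ′ (Digit false u v ∨' Digit true u v) ⇔ rk (ρ′ u) < length (word (rk (ρ′ v)))
              anyDigit⇔ ρ′ u v l = mk⇔
                [ symbolAt-<⁻ w ∘ to (ih false l) , symbolAt-<⁻ w ∘ to (ih true l) ]′
                λ i< → pick (symbolAt-<⁺ {w} i<)
                where
                w = word (rk (ρ′ v))
                pick : (Σ Bool λ c → symbolAt w (rk (ρ′ u)) ≡ just c) → Sat 𝔐 ρ′ (Digit false u v ∨' Digit true u v)
                pick (false , e) = inj₁ (from (ih false l) e)
                pick (true  , e) = inj₂ (from (ih true l) e)

              end⇔ : ∀ c → rk c < rk (ρ y) → Sat 𝔐 (ρ [ z ↦ c ]) End ⇔ rk (ρ x) ≡ length (word (rk c))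
              end⇔ c l = mk⇔
                (λ (none , a , s , some) → ≤-antisym
                  (subst (_≤ length (word (rk c))) (sym (to suc⇔ s)) (to (anyDigit⇔ ((ρ [ z ↦ c ]) [ y ↦ a ]) y z l) some))
                  (≮⇒≥ (none ∘ from (anyDigit⇔ (ρ [ z ↦ c ]) x z l))))
                (λ e → (λ some → <-irrefl e (to (anyDigit⇔ (ρ [ z ↦ c ]) x z l) some))
                     -- No word is empty, so the position just after its end has a predecessor.
                     , let x≡ = trans e (length-binary-suc (rk c))
                           (a , a≡) = predecessor x≡
                       in a , from suc⇔ (trans x≡ (cong suc (sym a≡)))
                            , from (anyDigit⇔ ((ρ [ z ↦ c ]) [ y ↦ a ]) y z l)
                                   (≤-reflexive (trans (cong suc a≡) (sym (length-binary-suc (rk c))))))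

              -- Every element other than the least is a child of a smaller one by `unchild`, and
              -- `symbolAt-∷ʳ` describes the word of a child.
              digitBody⇔ : ∀ b → Sat 𝔐 ρ (digitBody b) ⇔ symbolAt (word (rk (ρ y))) (rk (ρ x)) ≡ just b
              digitBody⇔ b = mk⇔ ⇒ (⇐ _ refl)
                where
                via-child : ∀ c d → rk (ρ y) ≡ child d (rk c) →
                  (symbolAt (word (rk c)) (rk (ρ x)) ≡ just b ⊎ (rk (ρ x) ≡ length (word (rk c)) × d ≡ b)) ⇔
                  symbolAt (word (rk (ρ y))) (rk (ρ x)) ≡ just b
                via-child c d e = subst
                  (λ w → (symbolAt (word (rk c)) (rk (ρ x)) ≡ just b ⊎ (rk (ρ x) ≡ length (word (rk c)) × d ≡ b)) ⇔
                         symbolAt w (rk (ρ x)) ≡ just b)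
                  (sym (trans (cong word e) (word-child d (rk c))))
                  (⇔-sym (symbolAt-∷ʳ (word (rk c)) d (rk (ρ x)) b))

                below : ∀ {c} d → rk (ρ y) ≡ child d (rk c) → rk c < rk (ρ y)
                below {c} d e = subst (rk c <_) (sym e) (<child d (rk c))

                anyChild : ∀ {c} → Sat 𝔐 (ρ [ z ↦ c ]) (Child false ∨' Child true) →
                           Σ Bool λ d → rk (ρ y) ≡ child d (rk c)
                anyChild {c} (inj₁ s) = false , to (child⇔ (ρ [ z ↦ c ]) false) s
                anyChild {c} (inj₂ s) = true  , to (child⇔ (ρ [ z ↦ c ]) true) s

                base : ∀ b → Sat 𝔐 ρ (digitBase b) ⇔ (symbolAt (word 0) (rk (ρ x)) ≡ just b × rk (ρ y) ≡ 0)
                base false = mk⇔ (λ f → ⊥-elim (f refl)) λ (e , _) → ⊥-elim (¬false {rk (ρ x)} e)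
                  where
                  ¬false : ∀ {i} → symbolAt (word 0) i ≢ just false
                  ¬false {zero} ()
                  ¬false {suc i} ()
                base true = mk⇔
                  (λ (ly , lx) → cong (symbolAt (word 0)) (to least⇔ lx) , to least⇔ ly)
                  (λ (e , y≡) → from least⇔ y≡ , from least⇔ (isZero {rk (ρ x)} e))
                  where
                  isZero : ∀ {i} → symbolAt (word 0) i ≡ just true → i ≡ 0
                  isZero {zero} _ = refl
                  isZero {suc i} ()

                ⇒ : Sat 𝔐 ρ (digitBody b) → symbolAt (word (rk (ρ y))) (rk (ρ x)) ≡ just b
                ⇒ (inj₁ s) = let (e , y≡) = to (base b) s in
                  trans (cong (λ r → symbolAt (word r) (rk (ρ x))) y≡) e
                ⇒ (inj₂ (inj₁ (c , ch , dig))) = let (d , e) = anyChild ch in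
                  to (via-child c d e) (inj₁ (to (ih b (below d e)) (to (Digit⇔ (ρ [ z ↦ c ]) b x z) dig)))
                ⇒ (inj₂ (inj₂ (c , ch , end))) = let e = to (child⇔ (ρ [ z ↦ c ]) b) ch in
                  to (via-child c b e) (inj₂ (to (end⇔ c (below b e)) end , refl))

                ⇐ : ∀ i → rk (ρ y) ≡ i → symbolAt (word (rk (ρ y))) (rk (ρ x)) ≡ just b → Sat 𝔐 ρ (digitBody b)
                ⇐ zero y≡ s = inj₁ (from (base b) (trans (cong (λ r → symbolAt (word r) (rk (ρ x))) (sym y≡)) s , y≡))
                ⇐ (suc i) y≡ s with unchild i
                ... | d , q , i≡ with element (<-trans (subst (q <_) (sym (trans y≡ i≡)) (<child d q)) (rk< (ρ y)))
                ...   | c , refl with from (via-child c d (trans y≡ i≡)) s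
                ...     | inj₁ s′ = inj₂ (inj₁ (c , anyChild⁻ d (from (child⇔ (ρ [ z ↦ c ]) d) (trans y≡ i≡))
                              , from (Digit⇔ (ρ [ z ↦ c ]) b x z) (from (ih b (below d (trans y≡ i≡))) s′)))
                  where
                  anyChild⁻ : ∀ d → Sat 𝔐 (ρ [ z ↦ c ]) (Child d) → Sat 𝔐 (ρ [ z ↦ c ]) (Child false ∨' Child true)
                  anyChild⁻ false = inj₁
                  anyChild⁻ true  = inj₂
                ...     | inj₂ (x≡ , refl) = inj₂ (inj₂ (c , from (child⇔ (ρ [ z ↦ c ]) d) (trans y≡ i≡)
                              , from (end⇔ c (below d (trans y≡ i≡))) x≡))

      below-induction : ∀ {P : Fin N → Set} (r : Fin N → ℕ) → (∀ a → (∀ {c} → r c < r a → P c) → P a) → ∀ a → P a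
      below-induction {P} r step a = go (suc (r a)) ≤-refl
        where
        go : ∀ n {a} → r a < n → P a
        go (suc n) {a} l = step a λ l′ → go n (≤-trans l′ (≤-pred l))

      standard⇒theory : Standard → ∀ (ρ : Env) → Sat 𝔐 ρ theory
      standard⇒theory S ρ =
          (λ l → <-irrefl refl (to lt⇔ l))
        , from (Sat-⇒ 𝔐 ρ (Lt x y ∧' Lt y z) (Lt x z)) (λ (l , l′) → from lt⇔ (<-trans (to lt⇔ l) (to lt⇔ l′)))
        , total
        , from (Sat-⇔ 𝔐 ρ (Suc x y) sucBody) (⇔-sym (sucBody⇔ ρ) ⇔-∘ suc⇔)
        , from (Sat-⇔ 𝔐 ρ (Dbl x y) dblBody) (⇔-sym (dblBody⇔ ρ (λ _ → dbl⇔)) ⇔-∘ dbl⇔)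
        , from (Sat-⇔ 𝔐 ρ (Digit false x y) (digitBody false)) (⇔-sym (digitBody⇔ false) ⇔-∘ digit⇔ false)
        , from (Sat-⇔ 𝔐 ρ (Digit true x y) (digitBody true)) (⇔-sym (digitBody⇔ true) ⇔-∘ digit⇔ true)
        , from (Sat-⇔ 𝔐 ρ (Pow x) powBody) (⇔-sym (powBody⇔ ρ (λ _ → pow⇔)) ⇔-∘ pow⇔)
        , from (Sat-⇔ 𝔐 ρ (Top x) topBody) (⇔-sym (topBody⇔ ρ pow⇔) ⇔-∘ top⇔)
        where
        open Standard S
        open Order ranking
        open Successor suc⇔
        open Doubling dbl⇔
        open Digits ρ (λ c _ → digit⇔ c)
        total : Sat 𝔐 ρ (Lt x y ∨' ((x ≐ y) ∨' Lt y x))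
        total with <-cmp (rk (ρ x)) (rk (ρ y))
        ... | tri< l _ _ = inj₁ (from lt⇔ l)
        ... | tri≈ _ e _ = inj₂ (inj₁ (rk-inj e))
        ... | tri> _ _ l = inj₂ (inj₂ (from lt⇔ l))

      theory⇒standard : (∀ (ρ : Env) → Sat 𝔐 ρ theory) → Standard
      theory⇒standard th = record
        { ranking = ranking ; suc⇔ = suc⇔ ; dbl⇔ = λ {a} → dbl⇔ a ; digit⇔ = λ c {_} {b} → digit⇔ b c
        ; pow⇔ = λ {a} → pow⇔ a
        ; top⇔ = λ {a} → topBody⇔ (env a a) (λ {b} → pow⇔ b) ⇔-∘
            to (Sat-⇔ 𝔐 (env a a) (Top x) topBody) (proj₂ (proj₂ (proj₂ (proj₂ (proj₂ (axioms a a)))))) }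
        where
        lt-trans : ∀ a b c → LtM a b → LtM b c → LtM a c
        lt-trans a b c p q = to (Sat-⇒ 𝔐 ρ (Lt x y ∧' Lt y z) (Lt x z)) (proj₁ (proj₂ (th ρ))) (p , q)
          where
          ρ : Env
          ρ x = a
          ρ y = b
          ρ (fs (fs _)) = c
        ranking : Ranking LtM
        ranking = LinearOrder.ranking (λ a b → 𝔐 LT (a ∷ b ∷ []))
          (λ a → proj₁ (th (env a a))) lt-trans (λ a b → proj₁ (proj₂ (proj₂ (th (env a b)))))
        open Ranking ranking
        open Order ranking

        axioms : ∀ a b → Sat 𝔐 (env a b) ((Suc x y ⇔' sucBody) ∧' ((Dbl x y ⇔' dblBody)
          ∧' ((Digit false x y ⇔' digitBody false) ∧' ((Digit true x y ⇔' digitBody true)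
          ∧' ((Pow x ⇔' powBody) ∧' (Top x ⇔' topBody))))))
        axioms a b = proj₂ (proj₂ (proj₂ (th (env a b))))

        suc⇔ : ∀ {a b} → SucM a b ⇔ rk b ≡ suc (rk a)
        suc⇔ {a} {b} = sucBody⇔ (env a b) ⇔-∘ to (Sat-⇔ 𝔐 (env a b) (Suc x y) sucBody) (proj₁ (axioms a b))
        open Successor suc⇔

        dbl⇔ : ∀ a {b} → DblM a b ⇔ rk b ≡ child false (rk a)
        dbl⇔ = below-induction rk λ a ih {b} → dblBody⇔ (env a b) (λ l → ih l) ⇔-∘
          to (Sat-⇔ 𝔐 (env a b) (Dbl x y) dblBody) (proj₁ (proj₂ (axioms a b)))
        open Doubling (λ {a} → dbl⇔ a)

        pow⇔ : ∀ a → PowM a ⇔ Σ ℕ λ i → suc (rk a) ≡ 2 ^ i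
        pow⇔ = below-induction rk λ a ih → powBody⇔ (env a a) (λ l → ih l) ⇔-∘
          to (Sat-⇔ 𝔐 (env a a) (Pow x) powBody) (proj₁ (proj₂ (proj₂ (proj₂ (proj₂ (axioms a a))))))

        digitAxiom : ∀ c a b → DigitM c a b ⇔ Sat 𝔐 (env a b) (digitBody c)
        digitAxiom false a b = to (Sat-⇔ 𝔐 (env a b) (Digit false x y) (digitBody false)) (proj₁ (proj₂ (proj₂ (axioms a b))))
        digitAxiom true  a b = to (Sat-⇔ 𝔐 (env a b) (Digit true x y) (digitBody true)) (proj₁ (proj₂ (proj₂ (proj₂ (axioms a b)))))

        digit⇔ : ∀ b c {a} → DigitM c a b ⇔ symbolAt (word (rk b)) (rk a) ≡ just c
        digit⇔ = below-induction rk λ b ih c {a} →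
          Digits.digitBody⇔ (env a b) (λ d l → ih l d) c ⇔-∘ digitAxiom c a b

-- Tuples of digits

+-*-unique : ∀ {h a a′ m m′} → a < h → a′ < h → a + h * m ≡ a′ + h * m′ → a ≡ a′ × m ≡ m′
+-*-unique {h} {a} {a′} {m} {m′} a< a′< e = a≡ , *-cancelˡ-≡ m m′ h (+-cancelˡ-≡ a _ _ (trans e (cong (_+ h * m′) (sym a≡))))
  where
  instance
    h≢0 : NonZero h
    h≢0 = >-nonZero (≤-<-trans z≤n a<)
  rem : ∀ {a} m → a < h → (a + h * m) % h ≡ a
  rem {a} m a< = trans (cong (λ n → (a + n) % h) (*-comm h m)) (trans ([m+kn]%n≡m%n a m h) (m<n⇒m%n≡m a<))
  a≡ : a ≡ a′
  a≡ = trans (sym (rem m a<)) (trans (cong (_% h) e) (rem m′ a′<))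

-- The number with least significant digits r v (v ∈ vs) in base h and leading part b.
val : {A : Set} → ℕ → (A → ℕ) → List A → ℕ → ℕ
val h r []       b = b
val h r (v ∷ vs) b = r v + h * val h r vs b

module _ {A : Set} {h : ℕ} where

  val-cong : ∀ {r r′ : A → ℕ} vs {b} → (∀ {v} → v ∈ vs → r v ≡ r′ v) → val h r vs b ≡ val h r′ vs b
  val-cong []       eq = refl
  val-cong (v ∷ vs) eq = cong₂ (λ a m → a + h * m) (eq (here refl)) (val-cong vs (eq ∘ there))

  val-injective : ∀ {r r′ : A → ℕ} {vs b b′} → All (λ v → r v < h) vs → All (λ v → r′ v < h) vs →
                  val h r vs b ≡ val h r′ vs b′ → b ≡ b′ × All (λ v → r v ≡ r′ v) vs
  val-injective []       []         e = e , []
  val-injective (l ∷ ls) (l′ ∷ ls′) e =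
    let (r≡ , e′) = +-*-unique l l′ e
        (b≡ , rs) = val-injective ls ls′ e′
    in b≡ , r≡ ∷ rs

  lead≤val : ∀ (r : A → ℕ) vs b → b * h ^ length vs ≤ val h r vs b
  lead≤val r []       b = ≤-reflexive (*-identityʳ b)
  lead≤val r (v ∷ vs) b = begin
    b * (h * h ^ length vs)   ≡⟨ *-assoc b h _ ⟨
    b * h * h ^ length vs     ≡⟨ cong (_* h ^ length vs) (*-comm b h) ⟩
    h * b * h ^ length vs     ≡⟨ *-assoc h b _ ⟩
    h * (b * h ^ length vs)   ≤⟨ *-monoʳ-≤ h (lead≤val r vs b) ⟩
    h * val h r vs b          ≤⟨ m≤n+m _ (r v) ⟩
    r v + h * val h r vs b    ∎
    where open ≤-Reasoning

  -- Used to turn the bounds on times and positions into bounds on the finitely many blocks.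
  lead< : ∀ (r : A → ℕ) vs {b B} → val h r vs b < B * h ^ length vs → b < B
  lead< r vs {b} {B} l = *-cancelʳ-< (h ^ length vs) b B (≤-<-trans (lead≤val r vs b) l)

  val-zeros : ∀ {r : A → ℕ} {vs} b → All (λ v → r v ≡ 0) vs → val h r vs b ≡ b * h ^ length vs
  val-zeros b []       = sym (*-identityʳ b)
  val-zeros {r} {v ∷ vs} b (e ∷ es) = begin
    r v + h * val h r vs b    ≡⟨ cong₂ (λ a m → a + h * m) e (val-zeros b es) ⟩
    h * (b * h ^ length vs)   ≡⟨ *-assoc h b _ ⟨
    h * b * h ^ length vs     ≡⟨ cong (_* h ^ length vs) (*-comm h b) ⟩
    b * h * h ^ length vs     ≡⟨ *-assoc b h _ ⟩
    b * (h * h ^ length vs)   ∎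
    where open ≡-Reasoning

  val-zero⁻ : ∀ {r : A → ℕ} vs {b} → 1 ≤ h → val h r vs b ≡ 0 → All (λ v → r v ≡ 0) vs × b ≡ 0
  val-zero⁻ []       1≤h e = [] , e
  val-zero⁻ {r} (v ∷ vs) {b} 1≤h e =
    let (zs , b≡) = val-zero⁻ vs 1≤h ([ (λ h≡0 → ⊥-elim (n≮0 (subst (0 <_) h≡0 1≤h))) , id ]′
                      (m*n≡0⇒m≡0∨n≡0 h (m+n≡0⇒n≡0 (r v) e)))
    in m+n≡0⇒m≡0 (r v) e ∷ zs , b≡

-- Incrementing a tuple of digits

module Counting (nCol arCol : ℕ) {j : ℕ} where
  open Arithmetic nCol arCol

  Var : Set
  Var = Fin (2 + j)

  -- φ with the digits vs and the leading part b replaced by those of the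
  -- successor.  Trailing maximal digits are known to become zero, so one
  -- scratch variable suffices.
  inc : List Var → (ℕ → Φ {j}) → ℕ → Φ
  inc []       φ b = φ (suc b)
  inc (v ∷ vs) φ b =
      (Top (fs v) ∧' ∃' (fs v) (Least fz (fs v) ∧' inc vs φ b))
    ∨' ∃' fz (Suc (fs v) fz ∧' ∃' (fs v) ((fs v ≐ fz) ∧' φ b))

  zeros : List Var → Φ {j}
  zeros []       = ⊤'
  zeros (v ∷ vs) = Least fz (fs v) ∧' zeros vs

  open import Data.List.Membership.DecPropositional (_≟F_ {2 + j}) using (_∈?_)

  module IncSemantics {N : ℕ} (𝔐 : Structure vocab N) (S : Semantics.Standard 𝔐) where
    open Semantics 𝔐
    open Standard S
    open Order {j} ranking

    h : ℕ
    h = 2 ^ level N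

    Env′ : Set
    Env′ = Fin (3 + j) → Fin N

    digits : Env′ → Var → ℕ
    digits ρ v = rk (ρ (fs v))

    value : Env′ → List Var → ℕ → ℕ
    value ρ = val h (digits ρ)

    Low : Env′ → List Var → Set
    Low ρ = All (λ v → digits ρ v < h)

    zeros⇔ : ∀ ρ vs → Sat 𝔐 ρ (zeros vs) ⇔ All (λ v → digits ρ v ≡ 0) vs
    zeros⇔ ρ []       = mk⇔ (λ _ → []) (λ _ → refl)
    zeros⇔ ρ (v ∷ vs) = mk⇔ (λ (s , t) → to least⇔ s ∷ to (zeros⇔ ρ vs) t)
                            (λ { (e ∷ es) → from least⇔ e , from (zeros⇔ ρ vs) es })

    -- No bound on the digits is assumed, since both branches add exactly one to the value whatever
    -- the digits are. Even the maximal digit may take the second branch when it has a successor in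
    -- the universe; it then becomes `h` without a carry, which is another name of the same number.
    inc-elim : ∀ φ {vs} → Unique vs → ∀ {ρ b} → Sat 𝔐 ρ (inc vs φ b) →
      Σ ℕ λ b′ → Σ Env′ λ ρ′ → Sat 𝔐 ρ′ (φ b′) × value ρ′ vs b′ ≡ suc (value ρ vs b)
        × (∀ {u} → u ∉ vs → ρ′ (fs u) ≡ ρ (fs u))
    inc-elim φ [] {ρ} {b} s = suc b , ρ , s , refl , λ _ → refl
    inc-elim φ {v ∷ vs} (v∉ ∷ uniq) {ρ} {b} (inj₁ (top , a , least , s)) =
      let ρ₁ = ρ [ fs v ↦ a ]
          (b′ , ρ′ , s′ , e , agree) = inc-elim φ uniq {ρ₁} s
          v≡ : digits ρ′ v ≡ 0
          v≡ = trans (cong rk (agree (Allₚ.All¬⇒¬Any v∉))) (to least⇔ least)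
          vs≡ : value ρ₁ vs b ≡ value ρ vs b
          vs≡ = val-cong vs λ u∈ → cong rk (not-updated ρ a (All.lookup v∉ u∈ ∘ fs-injective))
      in b′ , ρ′ , s′ , (begin
        digits ρ′ v + h * value ρ′ vs b′            ≡⟨ cong₂ (λ x y → x + h * y) v≡ (trans e (cong suc vs≡)) ⟩
        h * suc (value ρ vs b)                      ≡⟨ *-suc h (value ρ vs b) ⟩
        h + h * value ρ vs b                        ≡⟨ cong (_+ h * value ρ vs b) (to top⇔ top) ⟨
        suc (digits ρ v + h * value ρ vs b)         ∎)
      , λ u∉ → trans (agree (u∉ ∘ there)) (not-updated ρ a λ e → u∉ (here (sym (fs-injective e))))
      where open ≡-Reasoning
    inc-elim φ {v ∷ vs} (v∉ ∷ uniq) {ρ} {b} (inj₂ (c , s⋖c , a , a≡c , s)) =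
      b , ρ′ , s
      , cong₂ (λ x y → x + h * y) (trans (cong rk a≡c) (to suc⇔ s⋖c))
              (val-cong vs λ u∈ → cong rk (not-updated (ρ [ fz ↦ c ]) a (All.lookup v∉ u∈ ∘ fs-injective)))
      , λ u∉ → not-updated (ρ [ fz ↦ c ]) a λ e → u∉ (here (sym (fs-injective e)))
      where
      ρ′ : Env′
      ρ′ = (ρ [ fz ↦ c ]) [ fs v ↦ a ]

    IgnoresScratch : (ℕ → Φ {j}) → Set
    IgnoresScratch φ = ∀ b {ρ ρ′ : Env′} → (∀ u → ρ (fs u) ≡ ρ′ (fs u)) → Sat 𝔐 ρ (φ b) → Sat 𝔐 ρ′ (φ b)

    -- Here the digits must be low, so that the value determines them and the digits of `ρ′` are
    -- forced to be those that `inc` computes. The formula has to ignore the scratch variable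
    -- because `inc` overwrites it.
    inc-intro : ∀ {φ} → IgnoresScratch φ → ∀ {vs} → Unique vs → ∀ {ρ ρ′ b b′} → Low ρ vs → Low ρ′ vs →
      value ρ′ vs b′ ≡ suc (value ρ vs b) → (∀ {u} → u ∉ vs → ρ′ (fs u) ≡ ρ (fs u)) →
      Sat 𝔐 ρ′ (φ b′) → Sat 𝔐 ρ (inc vs φ b)
    inc-intro {φ} ign [] {b = b} _ _ refl agree s = ign (suc b) (λ u → agree λ ()) s
    inc-intro {φ} ign {v ∷ vs} (v∉ ∷ uniq) {ρ} {ρ′} {b} {b′} (l ∷ ls) (l′ ∷ ls′) e agree s
      with m≤n⇒m<n∨m≡n l
    ... | inj₁ l< =
      let (v≡ , e′)   = +-*-unique l′ l< e
          (b≡ , vs≡) = val-injective ls′ ls e′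
      in inj₂ (ρ′ (fs v) , from suc⇔ v≡ , ρ′ (fs v) , updated ρ₁ (fs v) (ρ′ (fs v))
              , ign b (same-at vs≡) (subst (λ i → Sat 𝔐 ρ′ (φ i)) b≡ s))
      where
      ρ₁ : Env′
      ρ₁ = ρ [ fz ↦ ρ′ (fs v) ]
      same-at : All (λ u → digits ρ′ u ≡ digits ρ u) vs → ∀ u → ρ′ (fs u) ≡ (ρ₁ [ fs v ↦ ρ′ (fs v) ]) (fs u)
      same-at vs≡ u with v ≟F u
      ... | yes refl = refl
      ... | no v≢u with u ∈? vs
      ...   | yes u∈ = rk-inj (All.lookup vs≡ u∈)
      ...   | no u∉  = agree λ { (here u≡v) → v≢u (sym u≡v) ; (there u∈) → u∉ u∈ }
    -- Carry: the digit is h - 1, and (h - 1) + h m + 1 = 0 + h (m + 1).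
    ... | inj₂ top =
      let (v≡ , e′) = +-*-unique {h} {digits ρ′ v} {0} l′ (≤-<-trans z≤n l) (trans e carry)
      in inj₁ (from top⇔ top , ρ′ (fs v)
              , from least⇔ (trans (cong rk (updated ρ (fs v) (ρ′ (fs v)))) v≡)
              , inc-intro ign uniq (All.tabulate low₁) ls′ (trans e′ (cong suc (sym vs≡))) agree₁ s)
      where
      ρ₁ : Env′
      ρ₁ = ρ [ fs v ↦ ρ′ (fs v) ]
      unchanged : ∀ {u} → v ≢ u → ρ₁ (fs u) ≡ ρ (fs u)
      unchanged v≢u = not-updated ρ (ρ′ (fs v)) (v≢u ∘ fs-injective)
      vs≡ : value ρ₁ vs b ≡ value ρ vs b
      vs≡ = val-cong vs λ u∈ → cong rk (unchanged (All.lookup v∉ u∈))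
      low₁ : ∀ {u} → u ∈ vs → digits ρ₁ u < h
      low₁ u∈ = subst (_< h) (cong rk (sym (unchanged (All.lookup v∉ u∈)))) (All.lookup ls u∈)
      agree₁ : ∀ {u} → u ∉ vs → ρ′ (fs u) ≡ ρ₁ (fs u)
      agree₁ {u} u∉ with v ≟F u
      ... | yes refl = refl
      ... | no v≢u   = agree λ { (here u≡v) → v≢u (sym u≡v) ; (there u∈) → u∉ u∈ }
      carry : suc (digits ρ v + h * value ρ vs b) ≡ 0 + h * suc (value ρ vs b)
      carry = trans (cong (_+ h * value ρ vs b) top) (sym (*-suc h (value ρ vs b)))

    -- Repeated division by `h`; what is left after the last digit becomes the leading part. The
    -- remainders are named by elements since `h ≤ N`.
    decode : 1 ≤ N → ∀ {vs} → Unique vs → ∀ (ρ : Env′) n →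
      Σ ℕ λ b → Σ Env′ λ ρ′ → value ρ′ vs b ≡ n × Low ρ′ vs × (∀ {u} → u ∉ vs → ρ′ (fs u) ≡ ρ (fs u))
    decode 1≤N [] ρ n = n , ρ , refl , [] , λ _ → refl
    decode 1≤N {v ∷ vs} (v∉ ∷ uniq) ρ n =
      let (b , ρ₁ , e , low , agree) = decode 1≤N uniq ρ (n / h)
          (a , a≡) = element (<-≤-trans (m%n<n n h) (2^level≤ 1≤N))
          ρ′ = ρ₁ [ fs v ↦ a ]
          unchanged : ∀ {u} → v ≢ u → ρ′ (fs u) ≡ ρ₁ (fs u)
          unchanged = λ v≢u → not-updated ρ₁ a (v≢u ∘ fs-injective)
          v≡ : digits ρ′ v ≡ n % h
          v≡ = trans (cong rk (updated ρ₁ (fs v) a)) a≡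
          vs≡ : value ρ′ vs b ≡ n / h
          vs≡ = trans (val-cong vs λ u∈ → cong rk (unchanged (All.lookup v∉ u∈))) e
      in b , ρ′
       , trans (cong₂ (λ x y → x + h * y) v≡ vs≡)
               (trans (cong (n % h +_) (*-comm h (n / h))) (sym (m≡m%n+[m/n]*n n h)))
       , subst (_< h) (sym v≡) (m%n<n n h)
         ∷ All.tabulate (λ u∈ → subst (_< h) (cong rk (sym (unchanged (All.lookup v∉ u∈)))) (All.lookup low u∈))
       , λ u∉ → trans (unchanged λ e → u∉ (here (sym e))) (agree (u∉ ∘ there))
      where
      instance
        h≢0 : NonZero h
        h≢0 = m^n≢0 2 (level N)

-- The sentence of a tiling system

does⇔ : ∀ {P : Set} (P? : Dec P) → (does P? ≡ true) ⇔ P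
does⇔ (yes p) = mk⇔ (λ _ → p) (λ _ → refl)
does⇔ (no ¬p) = mk⇔ (λ ()) (λ p → ⊥-elim (¬p p))

-- `k` counts the digits beyond the lowest one, so a time or a position has `suc k` digits. The
-- scratch variable and the two lowest digits are always present, which guarantees the three
-- variables needed by the axioms of arithmetic.
module TileFormula (S : TileSystem) (k C : ℕ) where
  open TileSystem S
  open Finite finite

  -- Enough for the rows 0, …, C hᵏ⁺¹ and the columns 0, …, 2 C hᵏ⁺¹.
  rowBlocks columnBlocks nCol arCol : ℕ
  rowBlocks    = suc C
  columnBlocks = suc (C + C)
  nCol         = rowBlocks * (columnBlocks * size)
  arCol        = 2 + (k + k)

  open Arithmetic nCol arCol
  open Counting nCol arCol {k + k}

  TileFml : Set
  TileFml = Φ {k + k}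

  rowVars columnVars columnVars⁺ : List Var
  rowVars     = fz ∷ List.tabulate (λ i → fs (fs (i ↑ˡ k)))
  columnVars⁺ = List.tabulate (λ i → fs (fs (k ↑ʳ i)))
  columnVars  = fs fz ∷ columnVars⁺

  rowVars-unique : Unique rowVars
  rowVars-unique = Allₚ.tabulate⁺ (λ i ())
    ∷ Uniqueₚ.tabulate⁺ (λ e → ↑ˡ-injective k _ _ (fs-injective (fs-injective e)))

  columnVars-unique : Unique columnVars
  columnVars-unique = Allₚ.tabulate⁺ (λ i ())
    ∷ Uniqueₚ.tabulate⁺ (λ e → ↑ʳ-injective k _ _ (fs-injective (fs-injective e)))

  disjoint : ∀ {u} → u ∈ rowVars → u ∉ columnVars
  disjoint (here refl) (there u∈) with ∈-tabulate⁻ u∈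
  ... | _ , ()
  disjoint (there u∈) (here refl) with ∈-tabulate⁻ u∈
  ... | _ , ()
  disjoint (there u∈) (there u∈′) with ∈-tabulate⁻ u∈ | ∈-tabulate⁻ u∈′
  ... | i , refl | i′ , e
    with trans (sym (splitAt-↑ˡ k i k)) (trans (cong (splitAt k) (fs-injective (fs-injective e))) (splitAt-↑ʳ k k i′))
  ...   | ()

  covering : ∀ u → u ∈ rowVars ⊎ u ∈ columnVars
  covering fz      = inj₁ (here refl)
  covering (fs fz) = inj₂ (here refl)
  covering (fs (fs v)) with splitAt k v in e
  ... | inj₁ i = inj₁ (there (subst (λ w → fs (fs w) ∈ _) (splitAt⁻¹-↑ˡ e) (∈-tabulate⁺ i)))
  ... | inj₂ i = inj₂ (there (subst (λ w → fs (fs w) ∈ _) (splitAt⁻¹-↑ʳ e) (∈-tabulate⁺ i)))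

  length-rowVars : length rowVars ≡ suc k
  length-rowVars = cong suc (Listₚ.length-tabulate (λ i → fs (fs (i ↑ˡ k))))

  length-columnVars : length columnVars ≡ suc k
  length-columnVars = cong suc (Listₚ.length-tabulate (λ i → fs (fs (k ↑ʳ i))))

  -- b and s are the blocks of the row and of the column; false for blocks
  -- beyond the last one.
  Col : ℕ → ℕ → Fin size → TileFml
  Col b s c with b <? rowBlocks | s <? columnBlocks
  ... | yes b< | yes s< = rel (COLOR (combine (fromℕ< b<) (combine (fromℕ< s<) c))) (tabulate fs)
  ... | _      | _      = ⊥'

  blocks : (ℕ → ℕ → TileFml) → TileFml
  blocks φ = ⋀ rowBlocks λ b → ⋀ columnBlocks λ s → φ (toℕ b) (toℕ s)

  eachTile : {Q : Tile → Set} → (∀ c → Dec (Q c)) → (ℕ → ℕ → Fin size → TileFml) → TileFml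
  eachTile Q? φ = blocks λ b s → ⋀ size λ c → forbidUnless (Q? (dec c)) (φ b s c)

  eachPair : {Q : Tile → Tile → Set} → (∀ c d → Dec (Q c d)) → (ℕ → ℕ → Fin size → Fin size → TileFml) → TileFml
  eachPair Q? φ = blocks λ b s → ⋀ size λ c → ⋀ size λ d → forbidUnless (Q? (dec c) (dec d)) (φ b s c d)

  -- The scratch variable is bound to the last element, which stands for `N`, and the lowest column
  -- digit is the position in its word. To say that nothing lies above it, the lowest row digit is
  -- requantified; its value is visible again after the negation.
  InputBit : Bool → ℕ → TileFml
  InputBit b zero    = zeros columnVars⁺ ∧' ∃' fz ((¬' ∃' (fs fz) (Lt fz (fs fz))) ∧' Digit b (fs (fs fz)) fz)
  InputBit b (suc s) = ⊥'

  Input : Maybe Bool → ℕ → TileFml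
  Input (just b) s = InputBit b s
  Input nothing  s = ¬' (InputBit false s ∨' InputBit true s)

  -- Block `C` with zero digits is the name of the last row.
  leftEdgeClause finalClause : ℕ → ℕ → Fin size → TileFml
  leftEdgeClause b s c = zeros columnVars ∧' Col b 0 c
  finalClause    b s c = zeros rowVars ∧' (zeros columnVars ∧' Col C 0 c)

  initialClause : Maybe Bool → ℕ → ℕ → Fin size → TileFml
  initialClause u b s c = zeros rowVars ∧' (Input u s ∧' Col 0 s c)

  horizontalClause verticalClause : ℕ → ℕ → Fin size → Fin size → TileFml
  horizontalClause b s c d = Col b s c ∧' inc columnVars (λ s′ → Col b s′ d) s
  verticalClause   b s c d = Col b s c ∧' inc rowVars (λ b′ → Col b′ s d) b

  initialTiles : Maybe Bool → TileFml
  initialTiles u = eachTile (initial? u) (initialClause u)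

  tileTheory : TileFml
  tileTheory =
       blocks (λ b s → ⋁ size (Col b s))
    ∧' (eachTile local? Col
    ∧' (eachTile leftEdge? leftEdgeClause
    ∧' (eachPair horizontal? horizontalClause
    ∧' (eachPair vertical? verticalClause
    ∧' ((initialTiles nothing ∧' (initialTiles (just false) ∧' initialTiles (just true)))
    ∧' eachTile final? finalClause)))))

  module _ {N : ℕ} (𝔐 : Structure vocab N) {ρ : Fin (3 + (k + k)) → Fin N} where

    Sat-blocks : ∀ φ → Sat 𝔐 ρ (blocks φ) ⇔ (∀ b s → b < rowBlocks → s < columnBlocks → Sat 𝔐 ρ (φ b s))
    Sat-blocks φ = mk⇔
      (λ sat b s b< s< → subst₂ (λ b s → Sat 𝔐 ρ (φ b s)) (toℕ-fromℕ< b<) (toℕ-fromℕ< s<)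
        (to (columns (toℕ (fromℕ< b<))) (to rows sat (fromℕ< b<)) (fromℕ< s<)))
      (λ sat → from rows λ b → from (columns (toℕ b)) λ s → sat (toℕ b) (toℕ s) (toℕ<n b) (toℕ<n s))
      where
      columns = λ b → Sat-⋀ 𝔐 {ρ} columnBlocks (λ s → φ b (toℕ s))
      rows    = Sat-⋀ 𝔐 {ρ} rowBlocks (λ b → ⋀ columnBlocks λ s → φ (toℕ b) (toℕ s))

    Sat-eachTile : ∀ {Q : Tile → Set} (Q? : ∀ c → Dec (Q c)) φ → Sat 𝔐 ρ (eachTile Q? φ) ⇔
      (∀ b s → b < rowBlocks → s < columnBlocks → ∀ c → Sat 𝔐 ρ (φ b s c) → Q (dec c))
    Sat-eachTile Q? φ = mk⇔
      (λ sat b s b< s< c → to (Sat-forbidUnless 𝔐 (Q? (dec c)) (φ b s c))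
        (to (tiles b s) (to (Sat-blocks clause) sat b s b< s<) c))
      (λ sat → from (Sat-blocks clause) λ b s b< s< → from (tiles b s) λ c →
        from (Sat-forbidUnless 𝔐 (Q? (dec c)) (φ b s c)) (sat b s b< s< c))
      where
      clause = λ b s → ⋀ size λ c → forbidUnless (Q? (dec c)) (φ b s c)
      tiles  = λ b s → Sat-⋀ 𝔐 {ρ} size (λ c → forbidUnless (Q? (dec c)) (φ b s c))

    Sat-eachPair : ∀ {Q : Tile → Tile → Set} (Q? : ∀ c d → Dec (Q c d)) φ → Sat 𝔐 ρ (eachPair Q? φ) ⇔
      (∀ b s → b < rowBlocks → s < columnBlocks → ∀ c d → Sat 𝔐 ρ (φ b s c d) → Q (dec c) (dec d))
    Sat-eachPair Q? φ = mk⇔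
      (λ sat b s b< s< c d → to (Sat-forbidUnless 𝔐 (Q? (dec c) (dec d)) (φ b s c d))
        (to (second b s c) (to (first b s) (to (Sat-blocks clause) sat b s b< s<) c) d))
      (λ sat → from (Sat-blocks clause) λ b s b< s< → from (first b s) λ c → from (second b s c) λ d →
        from (Sat-forbidUnless 𝔐 (Q? (dec c) (dec d)) (φ b s c d)) (sat b s b< s< c d))
      where
      clause = λ b s → ⋀ size λ c → ⋀ size λ d → forbidUnless (Q? (dec c) (dec d)) (φ b s c d)
      first  = λ b s → Sat-⋀ 𝔐 {ρ} size (λ c → ⋀ size λ d → forbidUnless (Q? (dec c) (dec d)) (φ b s c d))
      second = λ b s c → Sat-⋀ 𝔐 {ρ} size (λ d → forbidUnless (Q? (dec c) (dec d)) (φ b s c d))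

    Col-bounds : ∀ {b s c} → Sat 𝔐 ρ (Col b s c) → b < rowBlocks × s < columnBlocks
    Col-bounds {b} {s} sat with b <? rowBlocks | s <? columnBlocks
    ... | yes b< | yes s< = b< , s<
    ... | yes _  | no _   = ⊥-elim (sat refl)
    ... | no _   | _      = ⊥-elim (sat refl)

  Col-cong : ∀ {N} (𝔐 : Structure vocab N) {b s c} {ρ ρ′ : Fin (3 + (k + k)) → Fin N} →
             (∀ u → ρ (fs u) ≡ ρ′ (fs u)) → Sat 𝔐 ρ (Col b s c) → Sat 𝔐 ρ′ (Col b s c)
  Col-cong 𝔐 {b} {s} {c} {ρ} {ρ′} eq sat with b <? rowBlocks | s <? columnBlocks
  ... | yes b< | yes s< = trans (cong (𝔐 _) (trans (sym (Vecₚ.tabulate-∘ ρ′ fs))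
                            (trans (Vecₚ.tabulate-cong (sym ∘ eq)) (Vecₚ.tabulate-∘ ρ fs)))) sat
  ... | yes _  | no _   = ⊥-elim (sat refl)
  ... | no _   | _      = ⊥-elim (sat refl)

  -- From models to tilings

  module Numeric {N : ℕ} (𝔐 : Structure vocab N) (standard : Semantics.Standard 𝔐) where
    open Semantics 𝔐
    open Standard standard
    open IncSemantics 𝔐 standard

    last⇔ : ∀ {a} → (¬ Σ (Fin N) λ c → LtM a c) ⇔ suc (rk a) ≡ N
    last⇔ {a} = mk⇔
      (λ none → ≤-antisym (rk< a) (≮⇒≥ λ l → let (c , c≡) = element l in
         none (c , from lt⇔ (≤-reflexive (sym c≡)))))
      (λ e (c , l) → <⇒≱ (rk< c) (subst (_≤ rk c) e (to lt⇔ l)))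

    inputBit⇔ : ∀ ρ b s → Sat 𝔐 ρ (InputBit b s) ⇔ symbolAt (binary N) (value ρ columnVars s) ≡ just b
    inputBit⇔ ρ b s = mk⇔ (⇒ s) (⇐ s refl)
      where
      v : ℕ
      v = digits ρ (fs fz)
      ⇒ : ∀ s → Sat 𝔐 ρ (InputBit b s) → symbolAt (binary N) (value ρ columnVars s) ≡ just b
      ⇒ (suc s) sat = ⊥-elim (sat refl)
      ⇒ zero (zs , a , none , dig) = begin
        symbolAt (binary N) (v + h * value ρ columnVars⁺ 0)   ≡⟨ cong (λ m → symbolAt (binary N) (v + h * m)) (val-zeros 0 (to (zeros⇔ ρ columnVars⁺) zs)) ⟩
        symbolAt (binary N) (v + h * 0)                       ≡⟨ cong (symbolAt (binary N)) (trans (cong (v +_) (*-zeroʳ h)) (+-identityʳ v)) ⟩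
        symbolAt (binary N) v                                 ≡⟨ cong (λ n → symbolAt (binary n) v) (to last⇔ none) ⟨
        symbolAt (word (rk a)) v                              ≡⟨ to (digit⇔ b) (to (Digit⇔ (ρ [ fz ↦ a ]) b (fs (fs fz)) fz) dig) ⟩
        just b                                                ∎
        where open ≡-Reasoning
      ⇐ : ∀ s′ → s ≡ s′ → symbolAt (binary N) (value ρ columnVars s) ≡ just b → Sat 𝔐 ρ (InputBit b s)
      -- A position inside the word is smaller than `h`, so all higher digits and the block vanish.
      ⇐ s′ refl e with val-zero⁻ {h = h} {digits ρ} columnVars⁺ {s} (m^n>0 2 (level N)) high≡0
        where
        1≤N : 1 ≤ N
        1≤N = ≤-trans (s≤s z≤n) (rk< (ρ fz))
        value< : value ρ columnVars s < h
        value< = <-≤-trans (symbolAt-<⁻ (binary N) e) (length≤2^level 1≤N)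
        high≡0 : value ρ columnVars⁺ s ≡ 0
        high≡0 = n<1⇒n≡0 (*-cancelˡ-< h _ 1 (subst (h * value ρ columnVars⁺ s <_) (sym (*-identityʳ h))
                    (≤-<-trans (m≤n+m _ v) value<)))
      ... | zs , refl = from (zeros⇔ ρ columnVars⁺) zs , a , from last⇔ a≡
          , from (Digit⇔ (ρ [ fz ↦ a ]) b (fs (fs fz)) fz) (from (digit⇔ b) (begin
              symbolAt (word (rk a)) v                 ≡⟨ cong (λ n → symbolAt (binary n) v) a≡ ⟩
              symbolAt (binary N) v                    ≡⟨ cong (symbolAt (binary N)) (trans (cong (v +_) (*-zeroʳ h)) (+-identityʳ v)) ⟨
              symbolAt (binary N) (v + h * 0)          ≡⟨ cong (λ m → symbolAt (binary N) (v + h * m)) (val-zeros 0 zs) ⟨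
              symbolAt (binary N) (value ρ columnVars 0) ≡⟨ e ⟩
              just b                                   ∎))
        where
        open ≡-Reasoning
        pred< : pred N < N
        pred< = ≤-reflexive (suc-pred N {{>-nonZero (≤-trans (s≤s z≤n) (rk< (ρ fz)))}})
        a : Fin N
        a = proj₁ (element pred<)
        a≡ : suc (rk a) ≡ N
        a≡ = trans (cong suc (proj₂ (element pred<))) (suc-pred N {{>-nonZero (≤-trans (s≤s z≤n) (rk< (ρ fz)))}})

    input⇔ : ∀ ρ u s → Sat 𝔐 ρ (Input u s) ⇔ symbolAt (binary N) (value ρ columnVars s) ≡ u
    input⇔ ρ (just b) s = inputBit⇔ ρ b s
    input⇔ ρ nothing  s = mk⇔
      (λ none → outside (none ∘ inj₁ ∘ from (inputBit⇔ ρ false s)) (none ∘ inj₂ ∘ from (inputBit⇔ ρ true s)))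
      (λ e → [ (λ sat → clash (trans (sym e) (to (inputBit⇔ ρ false s) sat)))
             , (λ sat → clash (trans (sym e) (to (inputBit⇔ ρ true s) sat))) ]′)
      where
      clash : ∀ {b} → nothing ≢ just {A = Bool} b
      clash ()
      outside : ∀ {o : Maybe Bool} → o ≢ just false → o ≢ just true → o ≡ nothing
      outside {nothing}    _ _ = refl
      outside {just false} f _ = ⊥-elim (f refl)
      outside {just true}  _ t = ⊥-elim (t refl)

    initialTiles⇒ : ∀ ρ u → Sat 𝔐 ρ tileTheory → Sat 𝔐 ρ (initialTiles u)
    initialTiles⇒ ρ nothing      (_ , _ , _ , _ , _ , (n , _ , _) , _) = n
    initialTiles⇒ ρ (just false) (_ , _ , _ , _ , _ , (_ , f , _) , _) = f
    initialTiles⇒ ρ (just true)  (_ , _ , _ , _ , _ , (_ , _ , t) , _) = t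

    steps : ℕ
    steps = C * h ^ suc k

    record Placed (t p : ℕ) (tile : Tile) : Set where
      constructor placed
      field
        {b s}   : ℕ
        ρ       : Env′
        {c}     : Fin size
        tile≡   : tile ≡ dec c
        row≡    : value ρ rowVars b ≡ t
        column≡ : value ρ columnVars s ≡ p
        lowRow  : Low ρ rowVars
        lowCol  : Low ρ columnVars
        holds   : Sat 𝔐 ρ (Col b s c)

    module Extraction (1≤N : 1 ≤ N) (th : ∀ ρ → Sat 𝔐 ρ tileTheory) where

      placed-total : ∀ t p → t ≤ steps → p ≤ steps + steps → Σ Tile (Placed t p)
      placed-total t p t≤ p≤ with decode 1≤N rowVars-unique (λ _ → proj₁ (element 1≤N)) t
      ... | b , ρ₁ , row≡ , lowRow , _ with decode 1≤N columnVars-unique ρ₁ p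
      ...   | s , ρ , column≡ , lowCol , agree =
        let (c , sat) = to (Sat-⋁ 𝔐 size (Col b s)) (to (Sat-blocks 𝔐 (λ b s → ⋁ size (Col b s))) (proj₁ (th ρ)) b s b< s<)
        in dec c , placed ρ refl row≡′ column≡ lowRow′ lowCol sat
        where
        unchanged : ∀ {u} → u ∈ rowVars → digits ρ₁ u ≡ digits ρ u
        unchanged u∈ = cong rk (sym (agree (disjoint u∈)))
        row≡′ : value ρ rowVars b ≡ t
        row≡′ = trans (sym (val-cong {h = h} rowVars unchanged)) row≡
        lowRow′ : Low ρ rowVars
        lowRow′ = All.tabulate λ u∈ → subst (_< h) (unchanged u∈) (All.lookup lowRow u∈)
        -- The last row and the last column are themselves multiples of `h ^ suc k`, which costs one
        -- block beyond `B`.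
        bound : ∀ {n B} → n ≤ B * h ^ suc k → n < suc B * h ^ suc k
        bound {n} {B} le = +-mono-<-≤ (m^n>0 h {{m^n≢0 2 (level N)}} (suc k)) le
        b< : b < rowBlocks
        b< = lead< {h = h} (digits ρ) rowVars (subst₂ (λ n l → n < rowBlocks * h ^ l) (sym row≡′) (sym length-rowVars) (bound {B = C} t≤))
        s< : s < columnBlocks
        s< = lead< {h = h} (digits ρ) columnVars (subst₂ (λ n l → n < columnBlocks * h ^ l) (sym column≡) (sym length-columnVars)
               (bound {B = C + C} (subst (p ≤_) (sym (*-distribʳ-+ (h ^ suc k) C C)) p≤)))

      -- Equal row numbers force equal row digits and blocks, so the two assignments differ at most
      -- in the column variables and the scratch variable, as `inc-intro` requires.
      placed-horizontal : ∀ {t p c d} → Placed t p c → Placed t (suc p) d → Horizontal c d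
      placed-horizontal (placed {b} {s} ρ {c} refl r≡ p≡ lr lc sat) (placed {b′} ρ′ {d} refl r′≡ p′≡ lr′ lc′ sat′)
        with val-injective lr′ lr (trans r′≡ (sym r≡))
      ... | refl , same =
        let (_ , _ , _ , H , _) = th ρ
            (b< , s<) = Col-bounds 𝔐 {c = c} sat
        in to (Sat-eachPair 𝔐 horizontal? horizontalClause) H b s b< s< c d
             (sat , inc-intro (λ s₁ → Col-cong 𝔐 {b} {s₁} {d}) columnVars-unique lc lc′ (trans p′≡ (cong suc (sym p≡))) agree sat′)
        where
        agree : ∀ {u} → u ∉ columnVars → ρ′ (fs u) ≡ ρ (fs u)
        agree {u} u∉ with covering u
        ... | inj₁ u∈ = rk-inj (All.lookup same u∈)
        ... | inj₂ u∈ = ⊥-elim (u∉ u∈)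

      placed-vertical : ∀ {t p c d} → Placed t p c → Placed (suc t) p d → Vertical c d
      placed-vertical (placed {b} {s} ρ {c} refl r≡ p≡ lr lc sat) (placed {b′} {s′} ρ′ {d} refl r′≡ p′≡ lr′ lc′ sat′)
        with val-injective lc′ lc (trans p′≡ (sym p≡))
      ... | refl , same =
        let (_ , _ , _ , _ , V , _) = th ρ
            (b< , s<) = Col-bounds 𝔐 {c = c} sat
        in to (Sat-eachPair 𝔐 vertical? verticalClause) V b s b< s< c d
             (sat , inc-intro (λ b₁ → Col-cong 𝔐 {b₁} {s} {d}) rowVars-unique lr lr′ (trans r′≡ (cong suc (sym r≡))) agree sat′)
        where
        agree : ∀ {u} → u ∉ rowVars → ρ′ (fs u) ≡ ρ (fs u)
        agree {u} u∉ with covering u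
        ... | inj₁ u∈ = ⊥-elim (u∉ u∈)
        ... | inj₂ u∈ = rk-inj (All.lookup same u∈)

      1≤h : 1 ≤ h
      1≤h = m^n>0 2 (level N)

      placed-leftEdge : ∀ {t c} → Placed t 0 c → LeftEdge c
      placed-leftEdge (placed {b} {s} ρ {c} refl r≡ p≡ lr lc sat) with val-zero⁻ columnVars 1≤h p≡
      ... | zs , refl =
        let (_ , _ , L , _) = th ρ
            (b< , s<) = Col-bounds 𝔐 {c = c} sat
        in to (Sat-eachTile 𝔐 leftEdge? leftEdgeClause) L b 0 b< s< c
              (from (zeros⇔ ρ columnVars) zs , sat)

      placed-initial : ∀ {p c} → Placed 0 p c → Initial (symbolAt (binary N) p) c
      placed-initial (placed {b} {s} ρ {c} refl r≡ refl lr lc sat) with val-zero⁻ rowVars 1≤h r≡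
      ... | zs , refl =
        let (b< , s<) = Col-bounds 𝔐 {c = c} sat
            u = symbolAt (binary N) (value ρ columnVars s)
        in to (Sat-eachTile 𝔐 (initial? u) (initialClause u))
              (initialTiles⇒ ρ u (th ρ)) 0 s b< s< c
              (from (zeros⇔ ρ rowVars) zs , from (input⇔ ρ u s) refl , sat)

      placed-final : ∀ {c} → Placed steps 0 c → Final c
      placed-final (placed {b} {s} ρ {c} refl r≡ p≡ lr lc sat)
        with val-zero⁻ columnVars 1≤h p≡
           -- Comparison with the all-zero tuple in block `C`, which has the same value `steps`.
           | val-injective {r′ = λ _ → 0} {b′ = C} lr (All.tabulate λ _ → 1≤h) (trans r≡ (sym steps≡))
        where
        steps≡ : val h (λ _ → 0) rowVars C ≡ steps
        steps≡ = trans (val-zeros {h = h} C (All.tabulate {xs = rowVars} λ _ → refl)) (cong (λ l → C * h ^ l) length-rowVars)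
      ... | zc , refl | refl , zr =
        let (_ , _ , _ , _ , _ , _ , fin) = th ρ
            (b< , s<) = Col-bounds 𝔐 {c = c} sat
        in to (Sat-eachTile 𝔐 final? finalClause) fin C 0 b< s< c
              (from (zeros⇔ ρ rowVars) zr , from (zeros⇔ ρ columnVars) zc , sat)

      tiling : Tiling S (symbolAt (binary N)) steps Placed
      tiling = record
        { total      = placed-total
        ; local      = λ { (placed {b} {s} ρ {c} refl _ _ _ _ sat) →
            let (_ , L , _) = th ρ
                (b< , s<) = Col-bounds 𝔐 {c = c} sat
            in to (Sat-eachTile 𝔐 local? Col) L b s b< s< c sat }
        ; leftEdge   = placed-leftEdge
        ; horizontal = placed-horizontal
        ; vertical   = placed-vertical
        ; initial    = placed-initial
        ; final      = placed-final
        }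

  -- From tilings to models

  module Construction {N : ℕ} {f : ℕ → ℕ → Tile}
    (tiling : Tiling S (symbolAt (binary N)) (C * (2 ^ level N) ^ suc k) (λ t p c → f t p ≡ c)) where
    module Given = Tiling tiling

    valueAt : (Var → ℕ) → List Var → ℕ → ℕ
    valueAt = val (2 ^ level N)

    -- The colour depends only on the two numbers named, so tuples with digits beyond `h` are
    -- coloured consistently with the low ones; `f` is defined, and its constraints hold, on the
    -- whole quadrant.
    colorAt : (Var → ℕ) → ℕ → ℕ → Fin size
    colorAt r b s = enc (f (valueAt r rowVars b) (valueAt r columnVars s))

    colorAt-cong : ∀ {r r′} → (∀ u → r u ≡ r′ u) → ∀ b s → colorAt r b s ≡ colorAt r′ b s
    colorAt-cong r≡ b s = cong₂ (λ t p → enc (f t p)) (val-cong {h = 2 ^ level N} rowVars λ {u} _ → r≡ u)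
      (val-cong {h = 2 ^ level N} columnVars λ {u} _ → r≡ u)

    split : Fin nCol → Fin rowBlocks × Fin columnBlocks × Fin size
    split i = let (b , i′) = remQuot (columnBlocks * size) i in b , remQuot size i′

    split-combine : ∀ b s c → split (combine b (combine s c)) ≡ (b , s , c)
    split-combine b s c = trans
      (cong (λ (b , i) → b , remQuot {columnBlocks} size i) (remQuot-combine {rowBlocks} {columnBlocks * size} b (combine s c)))
      (cong (b ,_) (remQuot-combine {columnBlocks} {size} s c))

    colorHolds : (Var → ℕ) → Fin rowBlocks × Fin columnBlocks × Fin size → Bool
    colorHolds r (b , s , c) = does (colorAt r (toℕ b) (toℕ s) ≟F c)

    _≟S_ : (u v : Maybe Bool) → Dec (u ≡ v)
    _≟S_ = Maybeₚ.≡-dec Boolₚ._≟_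

    model : Structure vocab N
    model LT (a ∷ b ∷ [])     = does (toℕ a <? toℕ b)
    model SUC (a ∷ b ∷ [])    = does (toℕ b ≟ suc (toℕ a))
    model DBL (a ∷ b ∷ [])    = does (toℕ b ≟ child false (toℕ a))
    model DIGIT0 (a ∷ b ∷ []) = does (symbolAt (word (toℕ b)) (toℕ a) ≟S just false)
    model DIGIT1 (a ∷ b ∷ []) = does (symbolAt (word (toℕ b)) (toℕ a) ≟S just true)
    -- A power of two can only be the one whose exponent is its own level, which makes the property
    -- decidable by a single test.
    model POW (a ∷ [])        = does (suc (toℕ a) ≟ 2 ^ level (suc (toℕ a)))
    model TOP (a ∷ [])        = does (suc (toℕ a) ≟ 2 ^ level N)
    model (COLOR i) as        = colorHolds (λ u → toℕ (lookup as u)) (split i)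

    standard : Semantics.Standard model
    standard = record
      { ranking = record { rk = toℕ ; rk< = toℕ<n ; rk-inj = toℕ-injective
                         ; element = λ i< → fromℕ< i< , toℕ-fromℕ< i< ; lt⇔ = does⇔ (_ <? _) }
      ; suc⇔   = does⇔ (_ ≟ _)
      ; dbl⇔   = does⇔ (_ ≟ _)
      ; digit⇔ = λ { false → does⇔ (_ ≟S just false) ; true → does⇔ (_ ≟S just true) }
      ; pow⇔   = λ {a} → mk⇔
          (λ e → level (suc (toℕ a)) , to (does⇔ (suc (toℕ a) ≟ 2 ^ level (suc (toℕ a)))) e)
          (λ (i , e) → from (does⇔ (suc (toℕ a) ≟ 2 ^ level (suc (toℕ a)))) (trans e (cong (2 ^_)
            (2^-bracket-unique {i} {level (suc (toℕ a))} (≤-reflexive (sym e))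
              (subst (_< 2 ^ suc i) (sym e) (^-monoʳ-< 2 (s≤s (s≤s z≤n)) (≤-refl {suc i})))
              (2^level≤ (s≤s z≤n)) (<2^suc-level (s≤s z≤n))))))
      ; top⇔   = does⇔ (_ ≟ _)
      }

    open Semantics model
    open Standard standard
    open IncSemantics model standard
    open Numeric model standard

    Col⇔ : ∀ {ρ b s c} → b < rowBlocks → s < columnBlocks → Sat model ρ (Col b s c) ⇔ colorAt (digits ρ) b s ≡ c
    Col⇔ {ρ} {b} {s} {c} b<B s<B with b <? rowBlocks | s <? columnBlocks
    ... | no b≮ | _     = ⊥-elim (b≮ b<B)
    ... | yes _ | no s≮ = ⊥-elim (s≮ s<B)
    ... | yes b< | yes s< = subst (λ holds → holds ≡ true ⇔ colorAt (digits ρ) b s ≡ c) (sym holds≡)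
                              (does⇔ (colorAt (digits ρ) b s ≟F c))
      where
      r : Var → ℕ
      r u = toℕ (lookup (Vec.map ρ (tabulate fs)) u)
      r≡ : ∀ u → r u ≡ digits ρ u
      r≡ u = cong toℕ (trans (Vecₚ.lookup-map u ρ (tabulate fs)) (cong ρ (Vecₚ.lookup∘tabulate fs u)))
      holds≡ : colorHolds r (split (combine (fromℕ< b<) (combine (fromℕ< s<) c)))
             ≡ does (colorAt (digits ρ) b s ≟F c)
      holds≡ = trans (cong (colorHolds r) (split-combine (fromℕ< b<) (fromℕ< s<) c))
        (cong (λ x → does (x ≟F c)) (trans (colorAt-cong r≡ (toℕ (fromℕ< b<)) (toℕ (fromℕ< s<)))
          (cong₂ (colorAt (digits ρ)) (toℕ-fromℕ< b<) (toℕ-fromℕ< s<))))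

    tile≡ : ∀ {ρ b s c} → Sat model ρ (Col b s c) → f (value ρ rowVars b) (value ρ columnVars s) ≡ dec c
    tile≡ {ρ} {b} {s} {c} sat = let (b< , s<) = Col-bounds model {c = c} sat in
      trans (sym (dec-enc _)) (cong dec (to (Col⇔ b< s<) sat))

    module _ (ρ : Env′) where

      total-holds : ∀ b s → b < rowBlocks → s < columnBlocks → Sat model ρ (⋁ size (Col b s))
      total-holds b s b< s< = from (Sat-⋁ model size (Col b s)) (colorAt (digits ρ) b s , from (Col⇔ b< s<) refl)

      horizontal-holds : ∀ b s c d → Sat model ρ (horizontalClause b s c d) →
                         Horizontal (dec c) (dec d)
      horizontal-holds b s c d (sat , sat⁺)
        with inc-elim (λ s′ → Col b s′ d) columnVars-unique sat⁺
      ... | s′ , ρ′ , sat′ , e , agree = Given.horizontal (tile≡ {c = c} sat)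
        (trans (sym (cong₂ f (val-cong {h = h} rowVars λ u∈ → cong rk (agree (disjoint u∈))) e)) (tile≡ {c = d} sat′))

      vertical-holds : ∀ b s c d → Sat model ρ (verticalClause b s c d) →
                       Vertical (dec c) (dec d)
      vertical-holds b s c d (sat , sat⁺)
        with inc-elim (λ b′ → Col b′ s d) rowVars-unique sat⁺
      ... | b′ , ρ′ , sat′ , e , agree = Given.vertical (tile≡ {c = c} sat)
        (trans (sym (cong₂ f e (val-cong {h = h} columnVars λ u∈ → cong rk (agree λ u∈′ → disjoint u∈′ u∈)))) (tile≡ {c = d} sat′))

      value-zeros : ∀ vs b → Sat model ρ (zeros vs) → value ρ vs b ≡ b * h ^ length vs
      value-zeros vs b zs = val-zeros b (to (zeros⇔ ρ vs) zs)

      leftEdge-holds : ∀ b c → Sat model ρ (zeros columnVars ∧' Col b 0 c) → LeftEdge (dec c)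
      leftEdge-holds b c (zs , sat) =
        Given.leftEdge (subst (λ p → f (value ρ rowVars b) p ≡ dec c) (value-zeros columnVars 0 zs) (tile≡ {c = c} sat))

      initial-holds : ∀ u s c → Sat model ρ (zeros rowVars ∧' (Input u s ∧' Col 0 s c)) → Initial u (dec c)
      initial-holds u s c (zs , inp , sat) = subst (λ v → Initial v (dec c)) (to (input⇔ ρ u s) inp)
        (Given.initial (subst (λ t → f t (value ρ columnVars s) ≡ dec c) (value-zeros rowVars 0 zs) (tile≡ {c = c} sat)))

      final-holds : ∀ c → Sat model ρ (zeros rowVars ∧' (zeros columnVars ∧' Col C 0 c)) → Final (dec c)
      final-holds c (zr , zc , sat) = Given.final (trans (sym (cong₂ f
        (trans (value-zeros rowVars C zr) (cong (λ l → C * h ^ l) length-rowVars)) (value-zeros columnVars 0 zc)))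
        (tile≡ {c = c} sat))

      initialTiles-hold : ∀ u → Sat model ρ (initialTiles u)
      initialTiles-hold u = from (Sat-eachTile model (initial? u) (initialClause u)) λ b s _ _ c → initial-holds u s c

      tileTheory-holds : Sat model ρ tileTheory
      tileTheory-holds =
          from (Sat-blocks model (λ b s → ⋁ size (Col b s))) total-holds
        , from (Sat-eachTile model local? Col) (λ b s _ _ c sat → Given.local (tile≡ {c = c} sat))
        , from (Sat-eachTile model leftEdge? leftEdgeClause) (λ b s _ _ c → leftEdge-holds b c)
        , from (Sat-eachPair model horizontal? horizontalClause) (λ b s _ _ → horizontal-holds b s)
        , from (Sat-eachPair model vertical? verticalClause) (λ b s _ _ → vertical-holds b s)
        , (initialTiles-hold nothing , initialTiles-hold (just false) , initialTiles-hold (just true))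
        , from (Sat-eachTile model final? finalClause) (λ b s _ _ c → final-holds c)

  sentence : TileFml
  sentence = close (List.allFin (3 + (k + k))) (theory ∧' tileTheory)

  sentence-closed : Sentence sentence
  sentence-closed = noFree-close _ (theory ∧' tileTheory) λ y → inj₂ (∈-allFin y)

  tiling⇒spec : ∀ {N} f → 1 ≤ N →
    Tiling S (symbolAt (binary N)) (C * (2 ^ level N) ^ suc k) (λ t p c → f t p ≡ c) → Spec sentence N
  tiling⇒spec {N} f 1≤N tiling = 1≤N , model , λ ρ → from (eval⇔Sat model ρ sentence)
    (Sat-close⁺ model (List.allFin (3 + (k + k))) (theory ∧' tileTheory)
      (λ ρ → Semantics.standard⇒theory model standard ρ , tileTheory-holds ρ) ρ)
    where open Construction {N} {f} tiling

  spec⇒tiling : ∀ {N} → Spec sentence N → Σ (ℕ → ℕ → Tile → Set) λ P →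
    Tiling S (symbolAt (binary N)) (C * (2 ^ level N) ^ suc k) P
  spec⇒tiling {N} (1≤N , 𝔐 , holds) = _ , Numeric.Extraction.tiling 𝔐 standard 1≤N (proj₂ ∘ axioms)
    where
    axioms : ∀ ρ → Sat 𝔐 ρ (theory ∧' tileTheory)
    axioms ρ = Sat-close⁻ 𝔐 (List.allFin (3 + (k + k))) (theory ∧' tileTheory)
      (to (eval⇔Sat 𝔐 ρ sentence) (holds ρ)) ρ (λ _ → inj₁ refl)
    standard : Semantics.Standard 𝔐
    standard = Semantics.theory⇒standard 𝔐 (proj₁ ∘ axioms)

-- Time-bounded sets as spectra

module _ (k : ℕ) (A : ℕ → Set) (A-positive : ∀ N → A N → 1 ≤ N) where

  ntime⇒spec : NTIME (λ n → 2 ^ (suc k * n)) A → InSpec (3 + (k + k)) A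
  ntime⇒spec (M , c , decides) = vocab , sentence , sentence-closed , λ N → mk⇔ (⇒ N) (⇐ N)
    where
    open Machine M
    open TileFormula tileSystem k (c * 2 ^ suc k)
    open Arithmetic nCol arCol using (vocab)

    -- The word is one digit longer than the level; this extra digit contributes the factor
    -- `2 ^ suc k` of the constant, and the rest is a power of the base.
    time : ∀ {N} → 1 ≤ N → c * 2 ^ (suc k * length (binary N)) ≡ c * 2 ^ suc k * (2 ^ level N) ^ suc k
    time {N} 1≤N = begin
      c * 2 ^ (suc k * length (binary N))              ≡⟨ cong (λ l → c * 2 ^ (suc k * l)) (length≡suc-level 1≤N) ⟩
      c * 2 ^ (suc k * suc (level N))                  ≡⟨ cong (λ e → c * 2 ^ e) (*-suc (suc k) (level N)) ⟩
      c * 2 ^ (suc k + suc k * level N)                ≡⟨ cong (c *_) (^-distribˡ-+-* 2 (suc k) (suc k * level N)) ⟩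
      c * (2 ^ suc k * 2 ^ (suc k * level N))          ≡⟨ *-assoc c (2 ^ suc k) _ ⟨
      c * 2 ^ suc k * 2 ^ (suc k * level N)            ≡⟨ cong (λ e → c * 2 ^ suc k * 2 ^ e) (*-comm (suc k) (level N)) ⟩
      c * 2 ^ suc k * 2 ^ (level N * suc k)            ≡⟨ cong (c * 2 ^ suc k *_) (^-*-assoc 2 (level N) (suc k)) ⟨
      c * 2 ^ suc k * (2 ^ level N) ^ suc k            ∎
      where open ≡-Reasoning

    ⇒ : ∀ N → A N → Spec sentence N
    ⇒ N AN =
      let 1≤N = A-positive N AN
          acc = to (decides (binary N)) (N , 1≤N , AN , refl)
          (f , tiling) = FromRun.run⇒tiling _ (binary N) (subst (λ T → AccWithin M T (initConfig M (binary N))) (time 1≤N) acc)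
      in tiling⇒spec f 1≤N tiling

    ⇐ : ∀ N → Spec sentence N → A N
    ⇐ N spec@(1≤N , _) =
      let acc = tiling⇒run (proj₂ (spec⇒tiling spec))
          (N′ , _ , AN′ , e) = from (decides (binary N)) (subst (λ T → AccWithin M T (initConfig M (binary N))) (sym (time 1≤N)) acc)
      -- Acceptance only yields some member with the same word; by injectivity it is `N`.
      in subst A (binary-injective e) AN′

theorem3p2 : (k : ℕ) → 1 ≤ k → (A : ℕ → Set) → ((N : ℕ) → A N → 1 ≤ N) →
    NTIME (λ n → 2 ^ (k * n)) A → InSpec (2 * k + 1) A
theorem3p2 (suc k) _ A A-positive ntime =
  subst (λ K → InSpec K A) 3+2k≡ (ntime⇒spec k A A-positive ntime)
  where
  3+2k≡ : 3 + (k + k) ≡ 2 * suc k + 1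
  3+2k≡ rewrite +-identityʳ k | +-suc k k | +-comm (k + k) 1 = refl
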